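{- Let $\mathcal{S} = \{(t_i,p_i)\}_{1\le i\le r}$ be a canonic scheme with at least two voices, and let $$s = \max_i t_i - \min_i t_i$$ be its total time displacement. Then the limit $\lambda(\mathcal{S}) = \lim_{n\to\infty}\sqrt[n]{V_n(\mathcal{S})}$ defining the flexibility exists, and $\lambda(\mathcal{S})$ is an algebraic integer, that is, a root of a polynomial with integer coefficients and leading coefficient $1$, and the degree of this polynomial is at most $\frac{1}{7}V_s(\mathcal{S}) \le 7^{s-1}$.
   Context: Let $\mathbb{F}_7 = \mathbb{Z}/7\mathbb{Z}$. A canonic scheme $\mathcal{S}$ with $r$ voices is a set of ordered pairs $\{(t_i,p_i)\}_{1\le i\le r}$ with time displacements $t_i\in\mathbb{Z}$ and pitch displacements $p_i\in\mathbb{F}_7$, with no two $t_i$ equal, and with one of the ordered pairs optionally bearing the annotation $\mathrm{B}$ (the "marked bass voice"; at most one voice is marked, possibly none). A melody of length $n$ is a sequence $[x_1,\ldots,x_n]$ with $x_i\in\mathbb{F}_7$. Its realization under $\mathcal{S}$ is given by $y_{ti} = x_{t-t_i}+p_i$ (the note sung by voice $i$ at time $t\in\mathbb{Z}$), which exists exactly when $1\le t-t_i\le n$. A melody of length $n$ is a valid canon for $\mathcal{S}$ if for all voices $i,j$ and all $t\in\mathbb{Z}$ such that $y_{ti}$ and $y_{tj}$ both exist (i.e. $1\le t-t_i\le n$ and $1\le t-t_j\le n$): (a) $y_{ti}-y_{tj}\notin\{1,6\}$; and (b) if voice $j$ is the marked bass voice, then $y_{ti}-y_{tj}\ne 3$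 (all in $\mathbb{F}_7$). $V_n(\mathcal{S})$ denotes the number of valid canons of length $n$ for $\mathcal{S}$. The flexibility of $\mathcal{S}$ is $\lambda(\mathcal{S}) = \lim_{n\to\infty}\sqrt[n]{V_n(\mathcal{S})}$.
   Formalization: The degree bound V_s(S)/7 is claimed only when V_s(S) ≠ 0; if V_s(S) = 0 (e.g. times 0,1,2,3,4, pitches 0,6,4,6,0, no bass) it fails, as a monic polynomial of degree 0 has no root. All other claims are kept in that case. -}

module Defs where

open import Data.Fin.Base using (Fin; zero; suc; toℕ)
open import Data.Fin.Patterns using (1F; 3F; 6F)
open import Data.Fin.Properties using (all?)
import Data.Fin.Properties as Fin
open import Data.Integer.Base as ℤ using (ℤ; +_)
import Data.Integer.Properties as ℤ
open import Data.List.Base using (List; []; _∷_; allFin; cartesianProductWith; filter; length)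
open import Data.Maybe.Base using (Maybe; just)
import Data.Maybe.Properties as Maybe
open import Data.Nat.Base as ℕ using (ℕ; zero; suc)
open import Data.Nat.DivMod using (_mod_)
import Data.Nat.Properties as ℕ
open import Data.Product.Base using (∃; Σ; _×_; _,_)
open import Data.Rational.Base as ℚ using (ℚ; 0ℚ; 1ℚ; ½)
import Data.Rational.Properties as ℚ
open import Data.Rational.Solver using (module +-*-Solver)
open import Data.Sum.Base using (inj₁; inj₂)
open import Data.Vec.Base using (Vec; []; _∷_; lookup)
import Data.Vec.Functional as Vector
open import Function.Definitions using (Injective)
open import Relation.Binary.PropositionalEquality
  using (_≡_; _≢_; refl; sym; trans; cong; subst; subst₂)
open import Relation.Nullary.Decidable using (Dec; map′; _×-dec_; _→-dec_; ¬?)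

𝔽₇ : Set
𝔽₇ = Fin 7

infixl 6 _⊞_ _⊟_

_⊞_ : 𝔽₇ → 𝔽₇ → 𝔽₇
a ⊞ b = (toℕ a ℕ.+ toℕ b) mod 7

_⊟_ : 𝔽₇ → 𝔽₇ → 𝔽₇
a ⊟ b = (toℕ a ℕ.+ (7 ℕ.∸ toℕ b)) mod 7

record CanonicScheme (r : ℕ) : Set where
  field
    time   : Fin r → ℤ
    pitch  : Fin r → 𝔽₇
    time-injective : Injective _≡_ _≡_ time
    bass   : Maybe (Fin r)

open CanonicScheme public

-- The value for r = 0 is a dummy.
totalDisplacement : ∀ {r} → CanonicScheme r → ℕ
totalDisplacement {zero}  S = 0
totalDisplacement {suc r} S = ℤ.∣ maxTime ℤ.- minTime ∣
  where
  maxTime minTime : ℤ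
  maxTime = Vector.foldr ℤ._⊔_ (time S zero) (time S)
  minTime = Vector.foldr ℤ._⊓_ (time S zero) (time S)

Melody : ℕ → Set
Melody n = Vec 𝔽₇ n

-- The partial function (t , i) ↦ y_{ti}, given by its graph.  The note x_m
-- of the melody is stored at the index k : Fin n with m = 1 + k.
Sings : ∀ {r n} → CanonicScheme r → Melody n → ℤ → Fin r → 𝔽₇ → Set
Sings {n = n} S x t i y = Σ (Fin n) λ k →
  (t ℤ.- time S i ≡ + suc (toℕ k)) × (y ≡ lookup x k ⊞ pitch S i)

-- For v sung by voice j and u sung at the same time by any voice.
Compatible : ∀ {r} → CanonicScheme r → Fin r → 𝔽₇ → 𝔽₇ → Set
Compatible S j u v =
  (u ⊟ v ≢ 1F × u ⊟ v ≢ 6F) × (bass S ≡ just j → u ⊟ v ≢ 3F)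

ValidCanon : ∀ {r n} → CanonicScheme r → Melody n → Set
ValidCanon {r} S x = (i j : Fin r) (t : ℤ) {u v : 𝔽₇} →
  Sings S x t i u → Sings S x t j v → Compatible S j u v

private
  x+y-x≡y : ∀ x y → (x ℤ.+ y) ℤ.- x ≡ y
  x+y-x≡y x y = trans (cong (ℤ._- x) (ℤ.+-comm x y))
    (trans (ℤ.+-assoc y x (ℤ.- x))
      (trans (cong (λ z → y ℤ.+ z) (ℤ.+-inverseʳ x)) (ℤ.+-identityʳ y)))

  x+[t-x]≡t : ∀ x t → x ℤ.+ (t ℤ.- x) ≡ t
  x+[t-x]≡t x t = trans (sym (ℤ.+-assoc x t (ℤ.- x))) (x+y-x≡y x t)

compatible? : ∀ {r} (S : CanonicScheme r) j u v → Dec (Compatible S j u v)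
compatible? S j u v =
  (¬? (u ⊟ v Fin.≟ 1F) ×-dec ¬? (u ⊟ v Fin.≟ 6F))
    ×-dec (Maybe.≡-dec Fin._≟_ (bass S) (just j) →-dec ¬? (u ⊟ v Fin.≟ 3F))

-- ValidCanon with t eliminated: t = tᵢ + (1 + k) = tⱼ + (1 + l).
ValidCanonFin : ∀ {r n} → CanonicScheme r → Melody n → Set
ValidCanonFin {r} {n} S x = (i j : Fin r) (k l : Fin n) →
  (time S i ℤ.+ + suc (toℕ k)) ℤ.- time S j ≡ + suc (toℕ l) →
  Compatible S j (lookup x k ⊞ pitch S i) (lookup x l ⊞ pitch S j)

fin⇒valid : ∀ {r n} (S : CanonicScheme r) (x : Melody n) →
            ValidCanonFin S x → ValidCanon S x
fin⇒valid S x h i j t (k , t-tᵢ≡k , refl) (l , t-tⱼ≡l , refl) = h i j k l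
  (trans (cong (ℤ._- time S j)
           (trans (cong (λ z → time S i ℤ.+ z) (sym t-tᵢ≡k)) (x+[t-x]≡t (time S i) t)))
         t-tⱼ≡l)

valid⇒fin : ∀ {r n} (S : CanonicScheme r) (x : Melody n) →
            ValidCanon S x → ValidCanonFin S x
valid⇒fin S x valid i j k l eq =
  valid i j (time S i ℤ.+ + suc (toℕ k)) (k , x+y-x≡y (time S i) _ , refl) (l , eq , refl)

validCanon? : ∀ {r n} (S : CanonicScheme r) (x : Melody n) → Dec (ValidCanon S x)
validCanon? S x = map′ (fin⇒valid S x) (valid⇒fin S x)
  (all? λ i → all? λ j → all? λ k → all? λ l →
    (((time S i ℤ.+ + suc (toℕ k)) ℤ.- time S j) ℤ.≟ + suc (toℕ l))
      →-dec compatible? S j (lookup x k ⊞ pitch S i) (lookup x l ⊞ pitch S j))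

melodies : ∀ n → List (Melody n)
melodies zero    = [] ∷ []
melodies (suc n) = cartesianProductWith _∷_ (allFin 7) (melodies n)

-- V n S is V_n(S).
V : ∀ {r} → ℕ → CanonicScheme r → ℕ
V n S = length (filter (validCanon? S) (melodies n))

-- A real number is a Cauchy sequence of rationals, up to _≈ᴿ_.
record ℝ : Set where
  field
    seq    : ℕ → ℚ
    cauchy : ∀ ε → 0ℚ ℚ.< ε → ∃ λ N → ∀ m n → N ℕ.≤ m → N ℕ.≤ n →
             ℚ.∣ seq m ℚ.- seq n ∣ ℚ.< ε

open ℝ public

infix  4 _≈ᴿ_ _≤ᴿ_
infixl 6 _+ᴿ_ _-ᴿ_
infixl 7 _*ᴿ_
infixr 8 _^ᴿ_
infix  8 -ᴿ_
infix  4 _⟶_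

_≈ᴿ_ : ℝ → ℝ → Set
x ≈ᴿ y = ∀ ε → 0ℚ ℚ.< ε → ∃ λ N → ∀ n → N ℕ.≤ n →
         ℚ.∣ seq x n ℚ.- seq y n ∣ ℚ.< ε

_≤ᴿ_ : ℝ → ℝ → Set
x ≤ᴿ y = ∀ ε → 0ℚ ℚ.< ε → ∃ λ N → ∀ n → N ℕ.≤ n →
         seq x n ℚ.< seq y n ℚ.+ ε

private
  open +-*-Solver using (solve; _:=_; _:+_; _:*_; :-_; _:-_)

  cancel₁ : ∀ p q → (p ℚ.- q) ℚ.+ q ≡ p
  cancel₁ = solve 2 (λ a b → (a :- b) :+ b := a) refl

  cancel₂ : ∀ p q → (p ℚ.+ q) ℚ.- q ≡ p
  cancel₂ = solve 2 (λ a b → (a :+ b) :- b := a) refl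

  neg-minus : ∀ p q → ℚ.- (p ℚ.- q) ≡ q ℚ.- p
  neg-minus = solve 2 (λ a b → :- (a :- b) := b :- a) refl

  minus-neg : ∀ p q → ℚ.- (p ℚ.- q) ≡ (ℚ.- p) ℚ.- (ℚ.- q)
  minus-neg = solve 2 (λ a b → :- (a :- b) := (:- a) :- (:- b)) refl

  +-minus : ∀ p q r s → (p ℚ.- q) ℚ.+ (r ℚ.- s) ≡ (p ℚ.+ r) ℚ.- (q ℚ.+ s)
  +-minus = solve 4 (λ a b c d → (a :- b) :+ (c :- d) := (a :+ c) :- (b :+ d)) refl

  *-minus : ∀ p q r s →
    p ℚ.* (r ℚ.- s) ℚ.+ s ℚ.* (p ℚ.- q) ≡ p ℚ.* r ℚ.- q ℚ.* s
  *-minus = solve 4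
    (λ a b c d → a :* (c :- d) :+ d :* (a :- b) := a :* c :- b :* d) refl

  *-pos : ∀ {p q} → 0ℚ ℚ.< p → 0ℚ ℚ.< q → 0ℚ ℚ.< p ℚ.* q
  *-pos {p} {q} 0<p 0<q = subst (ℚ._< p ℚ.* q) (ℚ.*-zeroʳ p)
    (ℚ.*-monoʳ-<-pos p {{ℚ.positive 0<p}} 0<q)

  0<½ : 0ℚ ℚ.< ½
  0<½ = ℚ.positive⁻¹ ½

  ½ε+½ε≡ε : ∀ ε → ½ ℚ.* ε ℚ.+ ½ ℚ.* ε ≡ ε
  ½ε+½ε≡ε ε = trans (sym (ℚ.*-distribʳ-+ ε ½ ½)) (ℚ.*-identityˡ ε)

  ∣p-q∣≡∣q-p∣ : ∀ p q → ℚ.∣ p ℚ.- q ∣ ≡ ℚ.∣ q ℚ.- p ∣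
  ∣p-q∣≡∣q-p∣ p q = trans (sym (ℚ.∣-p∣≡∣p∣ (p ℚ.- q)))
    (cong ℚ.∣_∣ (neg-minus p q))

  ∣p∣≤∣p-q∣+∣q∣ : ∀ p q → ℚ.∣ p ∣ ℚ.≤ ℚ.∣ p ℚ.- q ∣ ℚ.+ ℚ.∣ q ∣
  ∣p∣≤∣p-q∣+∣q∣ p q = subst (λ z → ℚ.∣ z ∣ ℚ.≤ ℚ.∣ p ℚ.- q ∣ ℚ.+ ℚ.∣ q ∣)
    (cancel₁ p q)
    (ℚ.∣p+q∣≤∣p∣+∣q∣ (p ℚ.- q) q)

  ∣p∣-∣q∣≤∣p-q∣ : ∀ p q → ℚ.∣ p ∣ ℚ.- ℚ.∣ q ∣ ℚ.≤ ℚ.∣ p ℚ.- q ∣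
  ∣p∣-∣q∣≤∣p-q∣ p q = subst (ℚ.∣ p ∣ ℚ.- ℚ.∣ q ∣ ℚ.≤_)
    (cancel₂ ℚ.∣ p ℚ.- q ∣ ℚ.∣ q ∣)
    (ℚ.+-monoˡ-≤ (ℚ.- ℚ.∣ q ∣) (∣p∣≤∣p-q∣+∣q∣ p q))

  ∣∣p∣-∣q∣∣≤∣p-q∣ : ∀ p q → ℚ.∣ ℚ.∣ p ∣ ℚ.- ℚ.∣ q ∣ ∣ ℚ.≤ ℚ.∣ p ℚ.- q ∣
  ∣∣p∣-∣q∣∣≤∣p-q∣ p q with ℚ.∣p∣≡p∨∣p∣≡-p (ℚ.∣ p ∣ ℚ.- ℚ.∣ q ∣)
  ... | inj₁ eq = subst (ℚ._≤ ℚ.∣ p ℚ.- q ∣) (sym eq) (∣p∣-∣q∣≤∣p-q∣ p q)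
  ... | inj₂ eq = subst₂ ℚ._≤_
    (trans (sym (neg-minus ℚ.∣ p ∣ ℚ.∣ q ∣)) (sym eq))
    (∣p-q∣≡∣q-p∣ q p)
    (∣p∣-∣q∣≤∣p-q∣ q p)

  eventuallyBounded : ∀ x → ∃ λ B → 0ℚ ℚ.< B ×
    ∃ λ N → ∀ n → N ℕ.≤ n → ℚ.∣ seq x n ∣ ℚ.≤ B
  eventuallyBounded x with cauchy x 1ℚ (ℚ.positive⁻¹ 1ℚ)
  ... | N , close = 1ℚ ℚ.+ ℚ.∣ seq x N ∣
    , ℚ.+-mono-<-≤ (ℚ.positive⁻¹ 1ℚ) (ℚ.0≤∣p∣ (seq x N))
    , N
    , λ n N≤n → ℚ.≤-trans (∣p∣≤∣p-q∣+∣q∣ (seq x n) (seq x N))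
        (ℚ.+-monoˡ-≤ ℚ.∣ seq x N ∣ (ℚ.<⇒≤ (close n N N≤n ℕ.≤-refl)))

  *-mono-≤-< : ∀ {a b c d} → 0ℚ ℚ.≤ c → a ℚ.≤ b → 0ℚ ℚ.< b → c ℚ.< d →
               a ℚ.* c ℚ.< b ℚ.* d
  *-mono-≤-< {a} {b} {c} {d} 0≤c a≤b 0<b c<d = ℚ.≤-<-trans
    (ℚ.*-monoʳ-≤-nonNeg c {{ℚ.nonNegative 0≤c}} a≤b)
    (ℚ.*-monoʳ-<-pos b {{ℚ.positive 0<b}} c<d)

  product-bound : ∀ p q {B δ γ} → 0ℚ ℚ.< B → ℚ.∣ p ∣ ℚ.≤ B → ℚ.∣ q ∣ ℚ.< δ →
                  B ℚ.* δ ≡ γ → ℚ.∣ p ℚ.* q ∣ ℚ.< γ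
  product-bound p q 0<B ∣p∣≤B ∣q∣<δ Bδ≡γ =
    subst₂ ℚ._<_ (sym (ℚ.∣p*q∣≡∣p∣*∣q∣ p q)) Bδ≡γ
      (*-mono-≤-< (ℚ.0≤∣p∣ q) ∣p∣≤B 0<B ∣q∣<δ)

  ∣p+q∣<ε : ∀ p q ε → ℚ.∣ p ∣ ℚ.< ½ ℚ.* ε → ℚ.∣ q ∣ ℚ.< ½ ℚ.* ε →
            ℚ.∣ p ℚ.+ q ∣ ℚ.< ε
  ∣p+q∣<ε p q ε p< q< = ℚ.≤-<-trans (ℚ.∣p+q∣≤∣p∣+∣q∣ p q)
    (subst (ℚ.∣ p ∣ ℚ.+ ℚ.∣ q ∣ ℚ.<_) (½ε+½ε≡ε ε) (ℚ.+-mono-< p< q<))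

  +-close : ∀ a b c d ε → ℚ.∣ a ℚ.- b ∣ ℚ.< ½ ℚ.* ε → ℚ.∣ c ℚ.- d ∣ ℚ.< ½ ℚ.* ε →
            ℚ.∣ (a ℚ.+ c) ℚ.- (b ℚ.+ d) ∣ ℚ.< ε
  +-close a b c d ε p q = subst (λ z → ℚ.∣ z ∣ ℚ.< ε) (+-minus a b c d)
    (∣p+q∣<ε (a ℚ.- b) (c ℚ.- d) ε p q)

  *-close : ∀ a b c d ε →
            ℚ.∣ a ℚ.* (c ℚ.- d) ∣ ℚ.< ½ ℚ.* ε → ℚ.∣ d ℚ.* (a ℚ.- b) ∣ ℚ.< ½ ℚ.* ε →
            ℚ.∣ a ℚ.* c ℚ.- b ℚ.* d ∣ ℚ.< ε
  *-close a b c d ε p q = subst (λ z → ℚ.∣ z ∣ ℚ.< ε) (*-minus a b c d)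
    (∣p+q∣<ε (a ℚ.* (c ℚ.- d)) (d ℚ.* (a ℚ.- b)) ε p q)

  -- δ = ε / (2B)
  shrink : ∀ {ε B} → 0ℚ ℚ.< ε → 0ℚ ℚ.< B →
           ∃ λ δ → 0ℚ ℚ.< δ × B ℚ.* δ ≡ ½ ℚ.* ε
  shrink {ε} {B} 0<ε 0<B =
      1/B ℚ.* (½ ℚ.* ε)
    , *-pos (ℚ.positive⁻¹ 1/B {{ℚ.1/pos⇒pos B {{ℚ.positive 0<B}}}}) (*-pos 0<½ 0<ε)
    , trans (sym (ℚ.*-assoc B 1/B _))
        (trans (cong (ℚ._* (½ ℚ.* ε)) (ℚ.*-inverseʳ B {{B≢0}})) (ℚ.*-identityˡ _))
    where
    B≢0 = ℚ.pos⇒nonZero B {{ℚ.positive 0<B}}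
    1/B = (ℚ.1/ B) {{B≢0}}

fromℚ : ℚ → ℝ
fromℚ q .seq    _ = q
fromℚ q .cauchy ε 0<ε = 0 , λ _ _ _ _ →
  subst (λ z → ℚ.∣ z ∣ ℚ.< ε) (sym (ℚ.+-inverseʳ q)) 0<ε

fromℤ : ℤ → ℝ
fromℤ z = fromℚ (z ℚ./ 1)

fromℕ : ℕ → ℝ
fromℕ n = fromℤ (+ n)

-ᴿ_ : ℝ → ℝ
(-ᴿ x) .seq n = ℚ.- seq x n
(-ᴿ x) .cauchy ε 0<ε with cauchy x ε 0<ε
... | N , close = N , λ m n N≤m N≤n →
  subst (ℚ._< ε)
    (trans (sym (ℚ.∣-p∣≡∣p∣ (seq x m ℚ.- seq x n)))
      (cong ℚ.∣_∣ (minus-neg (seq x m) (seq x n))))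
    (close m n N≤m N≤n)

_+ᴿ_ : ℝ → ℝ → ℝ
(x +ᴿ y) .seq n = seq x n ℚ.+ seq y n
(x +ᴿ y) .cauchy ε 0<ε
  with cauchy x (½ ℚ.* ε) (*-pos 0<½ 0<ε) | cauchy y (½ ℚ.* ε) (*-pos 0<½ 0<ε)
... | M , closeˣ | N , closeʸ = M ℕ.⊔ N , λ m n ≤m ≤n →
  +-close (seq x m) (seq x n) (seq y m) (seq y n) ε
    (closeˣ m n (ℕ.m⊔n≤o⇒m≤o M N ≤m) (ℕ.m⊔n≤o⇒m≤o M N ≤n))
    (closeʸ m n (ℕ.m⊔n≤o⇒n≤o M N ≤m) (ℕ.m⊔n≤o⇒n≤o M N ≤n))

_-ᴿ_ : ℝ → ℝ → ℝ
x -ᴿ y = x +ᴿ (-ᴿ y)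

_*ᴿ_ : ℝ → ℝ → ℝ
(x *ᴿ y) .seq n = seq x n ℚ.* seq y n
(x *ᴿ y) .cauchy ε 0<ε =
  let
    A , 0<A , K , ∣x∣≤A = eventuallyBounded x
    B , 0<B , L , ∣y∣≤B = eventuallyBounded y
    δ , 0<δ , Aδ≡½ε = shrink 0<ε 0<A
    η , 0<η , Bη≡½ε = shrink 0<ε 0<B
    M , closeʸ = cauchy y δ 0<δ
    N , closeˣ = cauchy x η 0<η
  in (K ℕ.⊔ L) ℕ.⊔ (M ℕ.⊔ N) , λ m n ≤m ≤n →
  let
    K≤m = ℕ.m⊔n≤o⇒m≤o K L (ℕ.m⊔n≤o⇒m≤o (K ℕ.⊔ L) (M ℕ.⊔ N) ≤m)
    L≤n = ℕ.m⊔n≤o⇒n≤o K L (ℕ.m⊔n≤o⇒m≤o (K ℕ.⊔ L) (M ℕ.⊔ N) ≤n)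
    MN≤m = ℕ.m⊔n≤o⇒n≤o (K ℕ.⊔ L) (M ℕ.⊔ N) ≤m
    MN≤n = ℕ.m⊔n≤o⇒n≤o (K ℕ.⊔ L) (M ℕ.⊔ N) ≤n
  in *-close (seq x m) (seq x n) (seq y m) (seq y n) ε
    (product-bound (seq x m) (seq y m ℚ.- seq y n) 0<A (∣x∣≤A m K≤m)
      (closeʸ m n (ℕ.m⊔n≤o⇒m≤o M N MN≤m) (ℕ.m⊔n≤o⇒m≤o M N MN≤n)) Aδ≡½ε)
    (product-bound (seq y n) (seq x m ℚ.- seq x n) 0<B (∣y∣≤B n L≤n)
      (closeˣ m n (ℕ.m⊔n≤o⇒n≤o M N MN≤m) (ℕ.m⊔n≤o⇒n≤o M N MN≤n)) Bη≡½ε)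

∣_∣ᴿ : ℝ → ℝ
∣ x ∣ᴿ .seq n = ℚ.∣ seq x n ∣
∣ x ∣ᴿ .cauchy ε 0<ε with cauchy x ε 0<ε
... | N , close = N , λ m n N≤m N≤n →
  ℚ.≤-<-trans (∣∣p∣-∣q∣∣≤∣p-q∣ (seq x m) (seq x n)) (close m n N≤m N≤n)

_^ᴿ_ : ℝ → ℕ → ℝ
x ^ᴿ zero  = fromℕ 1
x ^ᴿ suc n = x *ᴿ x ^ᴿ n

-- Rational ε suffice, by density.
_⟶_ : (ℕ → ℝ) → ℝ → Set
a ⟶ L = ∀ ε → 0ℚ ℚ.< ε → ∃ λ N → ∀ n → N ℕ.≤ n → ∣ a n -ᴿ L ∣ᴿ ≤ᴿ fromℚ ε

-- ρ is the nonnegative n-th root of a.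
IsRoot : ℕ → ℝ → ℝ → Set
IsRoot n a ρ = fromℕ 0 ≤ᴿ ρ × ρ ^ᴿ n ≈ᴿ a

-- L is the limit of the n-th roots of V_n(S).  The roots are unique up to
-- _≈ᴿ_; the value of ρ at n = 0 is irrelevant.
IsFlexibility : ∀ {r} → CanonicScheme r → ℝ → Set
IsFlexibility S L = ∃ λ (ρ : ℕ → ℝ) →
  (∀ n → 1 ℕ.≤ n → IsRoot n (fromℕ (V n S)) (ρ n)) × ρ ⟶ L

-- evalMonic (c₀ ∷ … ∷ c_{d-1} ∷ []) x = c₀ + c₁ x + … + c_{d-1} x^{d-1} + x^d,
-- so that Vec ℤ d represents the monic integer polynomials of degree exactly d.
evalMonic : ∀ {d} → Vec ℤ d → ℝ → ℝ
evalMonic []       x = fromℕ 1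
evalMonic (c ∷ cs) x = fromℤ c +ᴿ x *ᴿ evalMonic cs x

{-# OPTIONS --safe #-}
module Submission where

-- Prepending a note to a canon is governed by its first s notes, and up to
-- translation there are N = V_s/7 such windows; so V_{n+s} is 7 times the sum
-- of the entries of Aⁿ1 for a nonnegative integer N × N matrix A.
--
-- For every rational q, Gaussian elimination of the first coordinate decides
-- between a nonnegative nonzero w with Aw ≥ qw and a nonnegative inverse of
-- q − A.  The first alternative gives Σ Aⁿ1 ≥ qⁿ, the second Aⁿ1 ≤ C qⁿ, so
-- the two alternatives are the halves of a located cut, which is the limit L.
--
-- Let χ(q) = det(q − A).  If p < L < q are rational, then v = (q − A)⁻¹1
-- dominates w/((q − p) Σ w) for the w belonging to p, while χ(q)v is bounded
-- by Cramer's rule.  Hence χ(q) = O(q − p), and χ(L) = 0.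

open import Defs
open import Data.Integer.Base using (ℤ; +_)
open import Data.Nat.Base using (ℕ; _∸_; _^_) renaming (_≤_ to _≤ℕ_)
open import Data.Product.Base using (Σ; _×_)
open import Data.Rational.Base using (_/_; _≤_)
open import Data.Vec.Base using (Vec)
open import Relation.Binary.PropositionalEquality using (_≢_)

open import Algebra.Bundles using (CommutativeRing)
import Algebra.Properties.Semiring.Exp as SemiringExp
import Algebra.Properties.Semiring.Sum as SemiringSum
open import Data.Bool.Base using (Bool; true; false; if_then_else_)
open import Data.Fin.Base as Fin using (Fin; zero; suc; toℕ; punchIn)
open import Data.Fin.Patterns using (0F; 1F; 3F; 6F)
open import Data.Fin.Permutation using (Permutation′; permutation)
import Data.Fin.Properties as Fin
import Data.Integer.Base as ℤ
import Data.Integer.Properties as ℤ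
open import Data.Integer.Tactic.RingSolver using () renaming (solve-∀ to ℤ-solve)
open import Data.List.Base as List using (List; []; _∷_; _++_; allFin; cartesianProductWith; filter; length; lookup)
import Data.List.Properties as List
open import Data.List.Membership.Propositional using (_∈_)
open import Data.List.Membership.Propositional.Properties
  using (∈-allFin; ∈-cartesianProductWith⁺; ∈-filter⁺; ∈-map⁺)
open import Data.List.Relation.Unary.Any using (here; index)
open import Data.List.Relation.Unary.Any.Properties using (lookup-index)
open import Data.Maybe.Base using (just)
open import Data.Nat.Base as ℕ using (zero; suc)
import Data.Nat.Properties as ℕ
open import Data.Product.Base using (∃; _,_; proj₁; proj₂)
open import Data.Rational.Base
  using (ℚ; mkℚ; 0ℚ; 1ℚ; _+_; _*_; _-_; -_; _<_; ∣_∣; 1/_; fromℚᵘ; toℚᵘ; positive; nonNegative)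
import Data.Rational.Base as ℚ
import Data.Rational.Properties as ℚ
open import Data.Rational.Solver using (module +-*-Solver)
open import Data.Rational.Unnormalised.Base as ℚᵘ using (mkℚᵘ)
import Data.Rational.Unnormalised.Properties as ℚᵘ
open import Data.Sum.Base using (_⊎_; inj₁; inj₂; [_,_]′)
open import Data.Vec.Base as Vec using ([]; _∷_)
import Data.Vec.Properties as Vec
open import Data.Vec.Functional using (Vector; foldr; tail)
open import Function.Base using (_∘_; id)
open import Relation.Binary.PropositionalEquality
  using (_≡_; refl; sym; trans; cong; cong₂; subst; subst₂; module ≡-Reasoning)
open import Relation.Nullary using (¬_; Dec; yes; no; does; contradiction)
open import Relation.Nullary.Decidable using (from-yes)

-- The matrix A may be reducible or periodic, and reals are Cauchy sequences without decidable
-- order. So L is approached only through rationals q, where every sign met in the elimination is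
-- decidable, and each alternative comes with a vector that serves as a certificate. The lower
-- certificate bounds the sum of the entries of Aⁿ1, not a single entry, and it does so for every n;
-- this is why periodicity does no harm. No eigenvector for L is ever at hand, so χ(L) = 0 cannot be
-- read off from a kernel. It follows instead from an estimate of |χ(q)| by the length of a bracket
-- p < q around L. Only the size of the quantities in Cramer's rule matters there, so signs are
-- dropped. Determinants are top coefficients of wedge products of columns: alternation then gives
-- Cramer's rule, and expansion along a column is the defining recursion of the wedge. If no canon
-- of length s is valid, A is the empty matrix and L = 0. The only monic polynomial of degree 0 is
-- the constant 1, which has no root, so the polynomial x is taken; hence the degree bound is
-- claimed for V_s ≠ 0.

ℚ-semiring = CommutativeRing.semiring ℚ.+-*-commutativeRing

open SemiringSum ℕ.+-*-semiring using ()
  renaming (sum to sumℕ; sum-cong-≗ to sumℕ-cong; ∑-comm to sumℕ-comm; sum-permute to sumℕ-permute;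
    *-distribˡ-sum to *-distribˡ-sumℕ; *-distribʳ-sum to *-distribʳ-sumℕ)
open SemiringSum ℚ-semiring
  using (sum; sum-cong-≗; sum-remove; *-distribˡ-sum; *-distribʳ-sum; ∑-distrib-+)
open SemiringExp ℚ-semiring using (^-homo-*) renaming (_^_ to infixr 8 _↑_)
open +-*-Solver using (solve; _:=_; _:+_; _:*_; :-_; _:-_; con)

-- Rational arithmetic

0≤+ : ∀ {p q} → 0ℚ ≤ p → 0ℚ ≤ q → 0ℚ ≤ p + q
0≤+ = ℚ.+-mono-≤

*-monoˡ : ∀ {r p q} → 0ℚ ≤ r → p ≤ q → r * p ≤ r * q
*-monoˡ {r} 0≤r = ℚ.*-monoˡ-≤-nonNeg r {{nonNegative 0≤r}}

*-monoʳ : ∀ {r p q} → 0ℚ ≤ r → p ≤ q → p * r ≤ q * r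
*-monoʳ {r} 0≤r = ℚ.*-monoʳ-≤-nonNeg r {{nonNegative 0≤r}}

*-mono-≤ : ∀ {p q r s} → 0ℚ ≤ p → 0ℚ ≤ s → p ≤ q → r ≤ s → p * r ≤ q * s
*-mono-≤ 0≤p 0≤s p≤q r≤s = ℚ.≤-trans (*-monoˡ 0≤p r≤s) (*-monoʳ 0≤s p≤q)

*-mono-<ˡ : ∀ {r p q} → 0ℚ < r → p < q → r * p < r * q
*-mono-<ˡ {r} 0<r = ℚ.*-monoʳ-<-pos r {{positive 0<r}}

*-cancelˡ-≤ : ∀ {r p q} → 0ℚ < r → r * p ≤ r * q → p ≤ q
*-cancelˡ-≤ {r} 0<r = ℚ.*-cancelˡ-≤-pos r {{positive 0<r}}

0≤* : ∀ {p q} → 0ℚ ≤ p → 0ℚ ≤ q → 0ℚ ≤ p * q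
0≤* {p} {q} 0≤p 0≤q = subst (_≤ p * q) (ℚ.*-zeroʳ p) (*-monoˡ 0≤p 0≤q)

0<* : ∀ {p q} → 0ℚ < p → 0ℚ < q → 0ℚ < p * q
0<* {p} {q} 0<p 0<q = subst (_< p * q) (ℚ.*-zeroʳ p) (*-mono-<ˡ 0<p 0<q)

0≤1 : 0ℚ ≤ 1ℚ
0≤1 = ℚ.nonNegative⁻¹ 1ℚ

0<1 : 0ℚ < 1ℚ
0<1 = ℚ.positive⁻¹ 1ℚ

+-cancelʳ : ∀ {p q} r → p + r ≤ q + r → p ≤ q
+-cancelʳ {p} {q} r h = subst₂ _≤_ (lem p r) (lem q r) (ℚ.+-monoˡ-≤ (- r) h)
  where
  lem = solve 2 (λ a b → (a :+ b) :- b := a) refl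

0≤q-p : ∀ {p q} → p ≤ q → 0ℚ ≤ q - p
0≤q-p {p} {q} p≤q = subst (_≤ q - p) (ℚ.+-inverseʳ p) (ℚ.+-monoˡ-≤ (- p) p≤q)

0<q-p : ∀ {p q} → p < q → 0ℚ < q - p
0<q-p {p} {q} p<q = subst (_< q - p) (ℚ.+-inverseʳ p) (ℚ.+-monoˡ-< (- p) p<q)

p≤p+q : ∀ {p q} → 0ℚ ≤ q → p ≤ p + q
p≤p+q {p} {q} 0≤q = subst (_≤ p + q) (ℚ.+-identityʳ p) (ℚ.+-monoʳ-≤ p 0≤q)

p≤q+p : ∀ {p q} → 0ℚ ≤ q → p ≤ q + p
p≤q+p {p} {q} 0≤q = subst (_≤ q + p) (ℚ.+-identityˡ p) (ℚ.+-monoˡ-≤ p 0≤q)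

p<p+q : ∀ {p q} → 0ℚ < q → p < p + q
p<p+q {p} {q} 0<q = subst (_< p + q) (ℚ.+-identityʳ p) (ℚ.+-monoʳ-< p 0<q)

∣p∣<ε : ∀ {p ε} → p < ε → - p < ε → ∣ p ∣ < ε
∣p∣<ε {p} p<ε -p<ε with ℚ.∣p∣≡p∨∣p∣≡-p p
... | inj₁ eq = subst (_< _) (sym eq) p<ε
... | inj₂ eq = subst (_< _) (sym eq) -p<ε

≤⊎> : ∀ p q → p ≤ q ⊎ q < p
≤⊎> p q with p ℚ.≤? q
... | yes p≤q = inj₁ p≤q
... | no p≰q  = inj₂ (ℚ.≰⇒> p≰q)

neg-sub : ∀ p q → - (p - q) ≡ q - p
neg-sub = solve 2 (λ p q → :- (p :- q) := q :- p) refl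

p+q-p : ∀ p q → p + q - p ≡ q
p+q-p = solve 2 (λ p q → p :+ q :- p := q) refl

inverse : ∀ {q} → 0ℚ < q → ∃ λ r → 0ℚ < r × q * r ≡ 1ℚ
inverse {q} 0<q = (1/ q) {{q≢0}}
  , ℚ.positive⁻¹ _ {{ℚ.1/pos⇒pos q {{positive 0<q}}}} , ℚ.*-inverseʳ q {{q≢0}}
  where q≢0 = ℚ.pos⇒nonZero q {{positive 0<q}}

fromℚᵘ-mono-≤ : ∀ {p q} → p ℚᵘ.≤ q → fromℚᵘ p ≤ fromℚᵘ q
fromℚᵘ-mono-≤ {p} {q} p≤q = ℚ.toℚᵘ-cancel-≤
  (ℚᵘ.≤-respˡ-≃ (ℚᵘ.≃-sym (ℚ.toℚᵘ-fromℚᵘ p))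
    (ℚᵘ.≤-respʳ-≃ (ℚᵘ.≃-sym (ℚ.toℚᵘ-fromℚᵘ q)) p≤q))

fromℚᵘ-mono-< : ∀ {p q} → p ℚᵘ.< q → fromℚᵘ p < fromℚᵘ q
fromℚᵘ-mono-< {p} {q} p<q = ℚ.toℚᵘ-cancel-<
  (ℚᵘ.<-respˡ-≃ (ℚᵘ.≃-sym (ℚ.toℚᵘ-fromℚᵘ p))
    (ℚᵘ.<-respʳ-≃ (ℚᵘ.≃-sym (ℚ.toℚᵘ-fromℚᵘ q)) p<q))

fromℚᵘ-homo-+ : ∀ p q → fromℚᵘ (p ℚᵘ.+ q) ≡ fromℚᵘ p + fromℚᵘ q
fromℚᵘ-homo-+ p q = ℚ.toℚᵘ-injective
  (ℚᵘ.≃-trans (ℚ.toℚᵘ-fromℚᵘ (p ℚᵘ.+ q))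
    (ℚᵘ.≃-trans (ℚᵘ.+-cong (ℚᵘ.≃-sym (ℚ.toℚᵘ-fromℚᵘ p)) (ℚᵘ.≃-sym (ℚ.toℚᵘ-fromℚᵘ q)))
      (ℚᵘ.≃-sym (ℚ.toℚᵘ-homo-+ (fromℚᵘ p) (fromℚᵘ q)))))

fromℚᵘ-homo-* : ∀ p q → fromℚᵘ (p ℚᵘ.* q) ≡ fromℚᵘ p * fromℚᵘ q
fromℚᵘ-homo-* p q = ℚ.toℚᵘ-injective
  (ℚᵘ.≃-trans (ℚ.toℚᵘ-fromℚᵘ (p ℚᵘ.* q))
    (ℚᵘ.≃-trans (ℚᵘ.*-cong (ℚᵘ.≃-sym (ℚ.toℚᵘ-fromℚᵘ p)) (ℚᵘ.≃-sym (ℚ.toℚᵘ-fromℚᵘ q)))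
      (ℚᵘ.≃-sym (ℚ.toℚᵘ-homo-* (fromℚᵘ p) (fromℚᵘ q)))))

-- Integers and unit fractions inside ℚ

opaque
  -- Opaque, so that the normalisation of fractions behind `_/_` is never unfolded in later terms;
  -- the laws of this block are the interface, and `ι≡/1` leads back to the form used in the
  -- theorem.
  ι : ℤ → ℚ
  ι z = z / 1

  ι≡/1 : ∀ z → ι z ≡ z / 1
  ι≡/1 z = refl

  ι-0 : ι (+ 0) ≡ 0ℚ
  ι-0 = refl

  ι-1 : ι (+ 1) ≡ 1ℚ
  ι-1 = refl

  ι-+ : ∀ a b → ι (a ℤ.+ b) ≡ ι a + ι b
  ι-+ a b = trans
    (cong ι (cong₂ ℤ._+_ (sym (ℤ.*-identityʳ a)) (sym (ℤ.*-identityʳ b))))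
    (fromℚᵘ-homo-+ (mkℚᵘ a 0) (mkℚᵘ b 0))

  ι-* : ∀ a b → ι (a ℤ.* b) ≡ ι a * ι b
  ι-* a b = fromℚᵘ-homo-* (mkℚᵘ a 0) (mkℚᵘ b 0)

  ι-neg : ∀ a → ι (ℤ.- a) ≡ - ι a
  ι-neg a = begin
    ι (ℤ.- a)                        ≡⟨ lem (ι a) (ι (ℤ.- a)) ⟩
    (ι a + ι (ℤ.- a)) - ι a          ≡⟨ cong (_- ι a) (ι-+ a (ℤ.- a)) ⟨
    ι (a ℤ.- a) - ι a                ≡⟨ cong (λ z → ι z - ι a) (ℤ.+-inverseʳ a) ⟩
    0ℚ - ι a                         ≡⟨ ℚ.+-identityˡ (- ι a) ⟩
    - ι a                            ∎
    where
    open ≡-Reasoning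
    lem : ∀ x y → y ≡ (x + y) - x
    lem = solve 2 (λ x y → y := (x :+ y) :- x) refl

  ι-mono-≤ : ∀ {a b} → a ℤ.≤ b → ι a ≤ ι b
  ι-mono-≤ {a} {b} a≤b = fromℚᵘ-mono-≤ {mkℚᵘ a 0} {mkℚᵘ b 0} (ℚᵘ.*≤* (ℤ.*-monoʳ-≤-nonNeg (+ 1) a≤b))

  ι-mono-< : ∀ {a b} → a ℤ.< b → ι a < ι b
  ι-mono-< {a} {b} a<b = fromℚᵘ-mono-< {mkℚᵘ a 0} {mkℚᵘ b 0} (ℚᵘ.*<* (ℤ.*-monoʳ-<-pos (+ 1) a<b))

  1≤ι : ∀ n → 1ℚ ≤ ι (+ suc n)
  1≤ι n = ι-mono-≤ {+ 1} {+ suc n} (ℤ.+≤+ (ℕ.s≤s ℕ.z≤n))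

  0≤ι : ∀ n → 0ℚ ≤ ι (+ n)
  0≤ι n = ι-mono-≤ {+ 0} {+ n} (ℤ.+≤+ ℕ.z≤n)

  mesh : ℕ → ℚ
  mesh k = + 1 / suc k

  mesh-0 : mesh 0 ≡ 1ℚ
  mesh-0 = refl

  0<mesh : ∀ k → 0ℚ < mesh k
  0<mesh k = fromℚᵘ-mono-< {mkℚᵘ (+ 0) 0} {mkℚᵘ (+ 1) k}
    (ℚᵘ.*<* (subst₂ ℤ._<_ (sym (ℤ.*-zeroˡ (+ suc k))) refl (ℤ.+<+ (ℕ.s≤s ℕ.z≤n))))

  mesh-anti : ∀ {k l} → k ≤ℕ l → mesh l ≤ mesh k
  mesh-anti {k} {l} k≤l = fromℚᵘ-mono-≤ {mkℚᵘ (+ 1) l} {mkℚᵘ (+ 1) k}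
    (ℚᵘ.*≤* (subst₂ ℤ._≤_ (sym (ℤ.*-identityˡ (+ suc k))) (sym (ℤ.*-identityˡ (+ suc l)))
      (ℤ.+≤+ (ℕ.s≤s k≤l))))

  ι*mesh : ∀ k → ι (+ suc k) * mesh k ≡ 1ℚ
  ι*mesh k = trans (sym (fromℚᵘ-homo-* (mkℚᵘ (+ suc k) 0) (mkℚᵘ (+ 1) k)))
    (ℚ.fromℚᵘ-cong {mkℚᵘ (+ suc k) 0 ℚᵘ.* mkℚᵘ (+ 1) k} {mkℚᵘ (+ 1) 0}
      (ℚᵘ.*≡* (cong (λ n → + n) (trans (ℕ.*-identityʳ (suc k ℕ.* 1)) (trans (ℕ.*-identityʳ (suc k))
        (sym (trans (ℕ.+-identityʳ _) (ℕ.+-identityʳ (suc k)))))))))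

  archimedean : ∀ {ε} → 0ℚ < ε → ∃ λ k → mesh k < ε
  -- Here ε = (m + 1)/(d + 1), and 1/(d + 2) < 1/(d + 1) ≤ ε.
  archimedean {ε@(mkℚ (+ suc m) d _)} _ = suc d ,
    subst (mesh (suc d) <_) (ℚ.fromℚᵘ-toℚᵘ ε) (fromℚᵘ-mono-< {mkℚᵘ (+ 1) (suc d)} {toℚᵘ ε}
      (ℚᵘ.*<* (subst₂ ℤ._<_ (sym (ℤ.*-identityˡ (+ suc d))) (ℤ.pos-* (suc m) (suc (suc d)))
        (ℤ.+<+ (ℕ.m≤m+n (suc (suc d)) _)))))
  archimedean {mkℚ (+ 0) d _} (ℚ.*<* (ℤ.+<+ ()))
  archimedean {mkℚ (ℤ.-[1+ n ]) d _} (ℚ.*<* ())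

-- Finite sums and powers of rationals

sum-zero : ∀ {n} (f : Vector ℚ n) → (∀ i → f i ≡ 0ℚ) → sum f ≡ 0ℚ
sum-zero {zero}  f f≗0 = refl
sum-zero {suc n} f f≗0 = cong₂ _+_ (f≗0 zero) (sum-zero (tail f) (f≗0 ∘ suc))

sum-mono : ∀ {n} {f g : Vector ℚ n} → (∀ i → f i ≤ g i) → sum f ≤ sum g
sum-mono {zero}  f≤g = ℚ.≤-refl
sum-mono {suc n} f≤g = ℚ.+-mono-≤ (f≤g zero) (sum-mono (f≤g ∘ suc))

0≤sum : ∀ {n} {f : Vector ℚ n} → (∀ i → 0ℚ ≤ f i) → 0ℚ ≤ sum f
0≤sum {zero}  0≤f = ℚ.≤-refl
0≤sum {suc n} 0≤f = 0≤+ (0≤f zero) (0≤sum (0≤f ∘ suc))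

≤sum : ∀ {n} {f : Vector ℚ n} → (∀ i → 0ℚ ≤ f i) → ∀ i → f i ≤ sum f
≤sum 0≤f zero    = p≤p+q (0≤sum (0≤f ∘ suc))
≤sum 0≤f (suc i) = ℚ.≤-trans (≤sum (0≤f ∘ suc) i) (p≤q+p (0≤f zero))

0≤↑ : ∀ {q} n → 0ℚ ≤ q → 0ℚ ≤ q ↑ n
0≤↑ zero    0≤q = 0≤1
0≤↑ (suc n) 0≤q = 0≤* 0≤q (0≤↑ n 0≤q)

0<↑ : ∀ {q} n → 0ℚ < q → 0ℚ < q ↑ n
0<↑ zero    0<q = 0<1
0<↑ (suc n) 0<q = 0<* 0<q (0<↑ n 0<q)

↑-mono : ∀ {p q} n → 0ℚ ≤ p → p ≤ q → p ↑ n ≤ q ↑ n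
↑-mono zero    0≤p p≤q = ℚ.≤-refl
↑-mono (suc n) 0≤p p≤q = *-mono-≤ 0≤p (0≤↑ n (ℚ.≤-trans 0≤p p≤q)) p≤q (↑-mono n 0≤p p≤q)

↑-cancel-< : ∀ {p q} n → 0ℚ ≤ q → p ↑ n < q ↑ n → p < q
↑-cancel-< {p} {q} n 0≤q pⁿ<qⁿ with q ℚ.≤? p
... | yes q≤p = contradiction (ℚ.<-≤-trans pⁿ<qⁿ (↑-mono n 0≤q q≤p)) (ℚ.<-irrefl refl)
... | no q≰p  = ℚ.≰⇒> q≰p

↑-mono-< : ∀ {p q} n → 0ℚ ≤ p → p < q → p ↑ suc n < q ↑ suc n
↑-mono-< {p} {q} n 0≤p p<q = ℚ.≤-<-trans
  (*-monoˡ 0≤p (↑-mono n 0≤p (ℚ.<⇒≤ p<q)))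
  (ℚ.*-monoˡ-<-pos (q ↑ n) {{positive (0<↑ n (ℚ.≤-<-trans 0≤p p<q))}} p<q)

↑-cancel-≤ : ∀ {p q} n → 0ℚ ≤ q → p ↑ suc n ≤ q ↑ suc n → p ≤ q
↑-cancel-≤ {p} {q} n 0≤q pⁿ≤qⁿ with p ℚ.≤? q
... | yes p≤q = p≤q
... | no p≰q  = contradiction (ℚ.<-≤-trans (↑-mono-< n 0≤q (ℚ.≰⇒> p≰q)) pⁿ≤qⁿ) (ℚ.<-irrefl refl)

1≤↑ : ∀ {q} n → 1ℚ ≤ q → 1ℚ ≤ q ↑ n
1≤↑ zero    1≤q = ℚ.≤-refl
1≤↑ (suc n) 1≤q = *-mono-≤ 0≤1 (0≤↑ n (ℚ.≤-trans 0≤1 1≤q)) 1≤q (1≤↑ n 1≤q)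

-- From qⁿ⁺¹ - pⁿ⁺¹ = q(qⁿ - pⁿ) + pⁿ(q - p) the constants on [0, B] satisfy K(n+1) = B K(n) + Bⁿ.
↑-lipschitz : ∀ n {B} → 0ℚ ≤ B → ∃ λ K → 0ℚ ≤ K ×
              ∀ {p q} → 0ℚ ≤ p → p ≤ q → q ≤ B → q ↑ n - p ↑ n ≤ K * (q - p)
↑-lipschitz zero    0≤B = 0ℚ , ℚ.≤-refl , λ {p} {q} _ _ _ → ℚ.≤-reflexive (sym (ℚ.*-zeroˡ (q - p)))
↑-lipschitz (suc n) {B} 0≤B with ↑-lipschitz n 0≤B
... | K , 0≤K , lip = B * K + B ↑ n , 0≤+ (0≤* 0≤B 0≤K) (0≤↑ n 0≤B) , λ {p} {q} 0≤p p≤q q≤B →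
  let 0≤q = ℚ.≤-trans 0≤p p≤q
      0≤d = 0≤q-p p≤q
  in begin
  q * q ↑ n - p * p ↑ n
    ≡⟨ solve 4 (λ q p x y → q :* x :- p :* y := q :* (x :- y) :+ y :* (q :- p)) refl q p (q ↑ n) (p ↑ n) ⟩
  q * (q ↑ n - p ↑ n) + p ↑ n * (q - p)
    ≤⟨ ℚ.+-mono-≤ (*-mono-≤ 0≤q (0≤* 0≤K 0≤d) q≤B (lip 0≤p p≤q q≤B))
                  (*-monoʳ 0≤d (↑-mono n 0≤p (ℚ.≤-trans p≤q q≤B))) ⟩
  B * (K * (q - p)) + B ↑ n * (q - p)
    ≡⟨ solve 4 (λ b k x d → b :* (k :* d) :+ x :* d := (b :* k :+ x) :* d) refl B K (B ↑ n) (q - p) ⟩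
  (B * K + B ↑ n) * (q - p) ∎
  where open ℚ.≤-Reasoning

ι-suc : ∀ n → ι (+ suc n) ≡ 1ℚ + ι (+ n)
ι-suc n = trans (ι-+ (+ 1) (+ n)) (cong (_+ ι (+ n)) ι-1)

meshVanishes : ∀ {K ε} → 0ℚ ≤ K → 0ℚ < ε → ∃ λ k₀ → ∀ k → k₀ ≤ℕ k → K * mesh k < ε
meshVanishes {K} {ε} 0≤K 0<ε = proj₁ fine , λ k k₀≤k → begin-strict
  K * mesh k                    ≤⟨ *-monoˡ 0≤K (mesh-anti k₀≤k) ⟩
  K * mesh (proj₁ fine)         ≤⟨ *-monoʳ (ℚ.<⇒≤ (0<mesh (proj₁ fine))) (p≤p+q {K} 0≤1) ⟩
  (K + 1ℚ) * mesh (proj₁ fine)  <⟨ *-mono-<ˡ 0<K+1 (proj₂ fine) ⟩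
  (K + 1ℚ) * (r * ε)            ≡⟨ ℚ.*-assoc (K + 1ℚ) r ε ⟨
  (K + 1ℚ) * r * ε              ≡⟨ cong (_* ε) (proj₂ (proj₂ inv)) ⟩
  1ℚ * ε                        ≡⟨ ℚ.*-identityˡ ε ⟩
  ε                             ∎
  where
  open ℚ.≤-Reasoning
  -- `K` may be zero, so `K + 1ℚ` is inverted instead.
  0<K+1 : 0ℚ < K + 1ℚ
  0<K+1 = ℚ.<-≤-trans 0<1 (p≤q+p 0≤K)
  inv = inverse 0<K+1
  r = proj₁ inv
  fine = archimedean (0<* (proj₁ (proj₂ inv)) 0<ε)

≤-clear : ∀ M d z m → 0ℚ ≤ z → z * m ≡ 1ℚ → M * m ≤ d → M ≤ z * d
≤-clear M d z m 0≤z zm≡1 Mm≤d = begin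
  M             ≡⟨ ℚ.*-identityʳ M ⟨
  M * 1ℚ        ≡⟨ cong (M *_) zm≡1 ⟨
  M * (z * m)   ≡⟨ solve 3 (λ m a b → m :* (a :* b) := a :* (m :* b)) refl M z m ⟩
  z * (M * m)   ≤⟨ *-monoˡ 0≤z Mm≤d ⟩
  z * d         ∎
  where open ℚ.≤-Reasoning

multiplesUnbounded : ∀ {M d} → 0ℚ ≤ M → 0ℚ < d → ∃ λ n₀ → ∀ n → n₀ ≤ℕ n → M ≤ ι (+ n) * d
multiplesUnbounded {M} {d} 0≤M 0<d = suc k , λ n k<n → ℚ.≤-trans
  (≤-clear M d (ι (+ suc k)) (mesh k) (0≤ι (suc k)) (ι*mesh k) (ℚ.<⇒≤ (small k ℕ.≤-refl)))
  (*-monoʳ (ℚ.<⇒≤ 0<d) (ι-mono-≤ {+ suc k} {+ n} (ℤ.+≤+ k<n)))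
  where
  vanishes = meshVanishes 0≤M 0<d
  k = proj₁ vanishes
  small = proj₂ vanishes

-- Bernoulli's inequality for (y/x)ⁿ, cleared of denominators: xⁿ(x + n d) ≤ x yⁿ with d = y - x.
-- From n₀ on, n d exceeds C x. This is what lets a slightly larger base absorb a constant factor.
↑-dominates : ∀ {x y C} → 0ℚ < x → x < y → 0ℚ ≤ C → ∃ λ n₀ → ∀ n → n₀ ≤ℕ n → C * x ↑ n ≤ y ↑ n
↑-dominates {x} {y} {C} 0<x x<y 0≤C = proj₁ unbounded , λ n n₀≤n → *-cancelˡ-≤ 0<x (begin
  x * (C * x ↑ n)               ≡⟨ solve 3 (λ x c z → x :* (c :* z) := z :* (c :* x)) refl x C (x ↑ n) ⟩
  x ↑ n * (C * x)               ≤⟨ *-monoˡ (0≤↑ n 0≤x) (ℚ.≤-trans (proj₂ unbounded n n₀≤n) (p≤q+p 0≤x)) ⟩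
  x ↑ n * (x + ι (+ n) * d)     ≤⟨ bernoulli n ⟩
  x * y ↑ n                     ∎)
  where
  open ℚ.≤-Reasoning
  d = y - x
  unbounded = multiplesUnbounded (0≤* 0≤C (ℚ.<⇒≤ 0<x)) (0<q-p x<y)
  0≤x = ℚ.<⇒≤ 0<x
  0≤d : 0ℚ ≤ d
  0≤d = ℚ.<⇒≤ (0<q-p x<y)
  bernoulli : ∀ n → x ↑ n * (x + ι (+ n) * d) ≤ x * y ↑ n
  bernoulli zero    = ℚ.≤-reflexive (trans (cong (λ z → 1ℚ * (x + z * d)) ι-0)
    (solve 2 (λ x d → con 1ℚ :* (x :+ con 0ℚ :* d) := x :* con 1ℚ) refl x d))
  bernoulli (suc n) = begin
    x * x ↑ n * (x + ι (+ suc n) * d)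
      ≡⟨ cong (λ z → x * x ↑ n * (x + z * d)) (ι-suc n) ⟩
    x * x ↑ n * (x + (1ℚ + ι (+ n)) * d)
      ≡⟨ solve 4 (λ x z i d → x :* z :* (x :+ (con 1ℚ :+ i) :* d) := x :* (z :* (x :+ i :* d)) :+ d :* (z :* x))
           refl x (x ↑ n) (ι (+ n)) d ⟩
    x * (x ↑ n * (x + ι (+ n) * d)) + d * (x ↑ n * x)
      ≤⟨ ℚ.+-mono-≤ (*-monoˡ 0≤x (bernoulli n))
           (*-monoˡ 0≤d (ℚ.≤-trans (*-monoˡ (0≤↑ n 0≤x) (p≤p+q (0≤* (0≤ι n) 0≤d))) (bernoulli n))) ⟩
    x * (x * y ↑ n) + d * (x * y ↑ n)
      ≡⟨ solve 3 (λ x y z → x :* (x :* z) :+ (y :- x) :* (x :* z) := x :* (y :* z)) refl x y (y ↑ n) ⟩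
    x * (y * y ↑ n) ∎

-- The exterior algebra of ℚⁿ

-- A form is given by its coefficients: I is the indicator of the set of
-- indices i for which eᵢ occurs in the basis element.
Form : ℕ → Set
Form n = Vec Bool n → ℚ

infixr 6 _∧_

-- Splits off the coordinate e₀. The minus sign comes from v ∧ (e₀ ∧ η) = - e₀ ∧ (v ∧ η), and the
-- empty case is 0 because the only vector of ℚ⁰ is 0.
_∧_ : ∀ {n} → Vector ℚ n → Form n → Form n
(v ∧ ω) []          = 0ℚ
(v ∧ ω) (false ∷ I) = (tail v ∧ λ J → ω (false ∷ J)) I
(v ∧ ω) (true ∷ I)  = v zero * ω (false ∷ I) - (tail v ∧ λ J → ω (true ∷ J)) I

∧-cong : ∀ {n} {u v : Vector ℚ n} {ω η : Form n} →
         (∀ i → u i ≡ v i) → (∀ I → ω I ≡ η I) → ∀ I → (u ∧ ω) I ≡ (v ∧ η) I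
∧-cong u≗v ω≗η []          = refl
∧-cong u≗v ω≗η (false ∷ I) = ∧-cong (u≗v ∘ suc) (ω≗η ∘ (false ∷_)) I
∧-cong u≗v ω≗η (true ∷ I)  = cong₂ _-_
  (cong₂ _*_ (u≗v zero) (ω≗η (false ∷ I)))
  (∧-cong (u≗v ∘ suc) (ω≗η ∘ (true ∷_)) I)

-- Stated for a ω - η because the `true` clause of `_∧_` has this shape; alternation and
-- anticommutation apply it to an inner wedge.
∧-linearʳ : ∀ {n} (v : Vector ℚ n) a (ω η : Form n) I →
            (v ∧ λ J → a * ω J - η J) I ≡ a * (v ∧ ω) I - (v ∧ η) I
∧-linearʳ v a ω η []          = solve 1 (λ a → con 0ℚ := a :* con 0ℚ :- con 0ℚ) refl a
∧-linearʳ v a ω η (false ∷ I) = ∧-linearʳ (tail v) a (ω ∘ (false ∷_)) (η ∘ (false ∷_)) I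
∧-linearʳ v a ω η (true ∷ I)
  rewrite ∧-linearʳ (tail v) a (ω ∘ (true ∷_)) (η ∘ (true ∷_)) I =
  solve 6 (λ a v₀ x y z w → v₀ :* (a :* x :- y) :- (a :* z :- w)
                         := a :* (v₀ :* x :- z) :- (v₀ :* y :- w))
    refl a (v zero) (ω (false ∷ I)) (η (false ∷ I)) _ _

∧-linearˡ : ∀ {n} a (u v : Vector ℚ n) (ω : Form n) I →
            ((λ i → a * u i + v i) ∧ ω) I ≡ a * (u ∧ ω) I + (v ∧ ω) I
∧-linearˡ a u v ω []          = solve 1 (λ a → con 0ℚ := a :* con 0ℚ :+ con 0ℚ) refl a
∧-linearˡ a u v ω (false ∷ I) = ∧-linearˡ a (tail u) (tail v) (ω ∘ (false ∷_)) I
∧-linearˡ a u v ω (true ∷ I)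
  rewrite ∧-linearˡ a (tail u) (tail v) (ω ∘ (true ∷_)) I =
  solve 6 (λ a u₀ v₀ x z w → (a :* u₀ :+ v₀) :* x :- (a :* z :+ w)
                          := a :* (u₀ :* x :- z) :+ (v₀ :* x :- w))
    refl a (u zero) (v zero) (ω (false ∷ I)) _ _

∧-scaleʳ : ∀ {n} (v : Vector ℚ n) a (ω : Form n) I →
           (v ∧ λ J → a * ω J) I ≡ a * (v ∧ ω) I
∧-scaleʳ v a ω []          = sym (ℚ.*-zeroʳ a)
∧-scaleʳ v a ω (false ∷ I) = ∧-scaleʳ (tail v) a (ω ∘ (false ∷_)) I
∧-scaleʳ v a ω (true ∷ I)
  rewrite ∧-scaleʳ (tail v) a (ω ∘ (true ∷_)) I =
  solve 4 (λ a v₀ x z → v₀ :* (a :* x) :- a :* z := a :* (v₀ :* x :- z))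
    refl a (v zero) (ω (false ∷ I)) _

∧-zeroʳ : ∀ {n} (v : Vector ℚ n) (ω : Form n) → (∀ I → ω I ≡ 0ℚ) → ∀ I → (v ∧ ω) I ≡ 0ℚ
∧-zeroʳ v ω ω≗0 I = begin
  (v ∧ ω) I              ≡⟨ ∧-cong (λ _ → refl) (λ J → trans (ω≗0 J) (sym (ℚ.*-zeroˡ (ω J)))) I ⟩
  (v ∧ λ J → 0ℚ * ω J) I ≡⟨ ∧-scaleʳ v 0ℚ ω I ⟩
  0ℚ * (v ∧ ω) I         ≡⟨ ℚ.*-zeroˡ ((v ∧ ω) I) ⟩
  0ℚ                     ∎
  where open ≡-Reasoning

∧-zeroˡ : ∀ {n} (ω : Form n) I → ((λ _ → 0ℚ) ∧ ω) I ≡ 0ℚ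
∧-zeroˡ ω []          = refl
∧-zeroˡ ω (false ∷ I) = ∧-zeroˡ (ω ∘ (false ∷_)) I
∧-zeroˡ ω (true ∷ I)  rewrite ∧-zeroˡ (ω ∘ (true ∷_)) I =
  solve 1 (λ x → con 0ℚ :* x :- con 0ℚ := con 0ℚ) refl (ω (false ∷ I))

∧-alternating : ∀ {n} (v : Vector ℚ n) (ω : Form n) I → (v ∧ v ∧ ω) I ≡ 0ℚ
∧-alternating v ω []          = refl
∧-alternating v ω (false ∷ I) = ∧-alternating (tail v) (ω ∘ (false ∷_)) I
∧-alternating v ω (true ∷ I)
  rewrite ∧-linearʳ (tail v) (v zero) (ω ∘ (false ∷_)) (tail v ∧ ω ∘ (true ∷_)) I
        | ∧-alternating (tail v) (ω ∘ (true ∷_)) I =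
  solve 2 (λ v₀ x → v₀ :* x :- (v₀ :* x :- con 0ℚ) := con 0ℚ)
    refl (v zero) ((tail v ∧ ω ∘ (false ∷_)) I)

∧-anticomm : ∀ {n} (u v : Vector ℚ n) (ω : Form n) I → (u ∧ v ∧ ω) I ≡ - (v ∧ u ∧ ω) I
∧-anticomm u v ω []          = refl
∧-anticomm u v ω (false ∷ I) = ∧-anticomm (tail u) (tail v) (ω ∘ (false ∷_)) I
∧-anticomm u v ω (true ∷ I)
  rewrite ∧-linearʳ (tail u) (v zero) (ω ∘ (false ∷_)) (tail v ∧ ω ∘ (true ∷_)) I
        | ∧-linearʳ (tail v) (u zero) (ω ∘ (false ∷_)) (tail u ∧ ω ∘ (true ∷_)) I
        | ∧-anticomm (tail u) (tail v) (ω ∘ (true ∷_)) I =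
  solve 5 (λ u₀ v₀ x y z → u₀ :* x :- (v₀ :* y :- (:- z)) := :- (v₀ :* y :- (u₀ :* x :- z)))
    refl (u zero) (v zero) ((tail v ∧ ω ∘ (false ∷_)) I) ((tail u ∧ ω ∘ (false ∷_)) I) _

∧-sumˡ : ∀ {n m} (w : Vector ℚ m) (d : Fin m → Vector ℚ n) (ω : Form n) I →
         ((λ k → sum λ j → w j * d j k) ∧ ω) I ≡ sum λ j → w j * (d j ∧ ω) I
∧-sumˡ {m = zero}  w d ω I = ∧-zeroˡ ω I
∧-sumˡ {m = suc m} w d ω I = trans
  (∧-linearˡ (w zero) (d zero) (λ k → sum λ j → w (suc j) * d (suc j) k) ω I)
  (cong (λ z → w zero * (d zero ∧ ω) I + z) (∧-sumˡ (tail w) (tail d) ω I))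

unit : ∀ {n} → Form n
unit []          = 1ℚ
unit (false ∷ I) = unit I
unit (true ∷ I)  = 0ℚ

⋀ : ∀ {n m} → (Fin m → Vector ℚ n) → Form n
⋀ {m = zero}  c = unit
⋀ {m = suc m} c = c zero ∧ ⋀ (tail c)

-- A basis element without e₀ does not see the zeroth coordinates. This identifies the minor in the
-- expansion of `charPoly` with a smaller `charPoly`.
⋀-restrict : ∀ {n m} (c : Fin m → Vector ℚ (suc n)) I → ⋀ c (false ∷ I) ≡ ⋀ (tail ∘ c) I
⋀-restrict {m = zero}  c I = refl
⋀-restrict {m = suc m} c I = ∧-cong (λ _ → refl) (⋀-restrict (tail c)) I

∧⋀-repeated : ∀ {n m} (c : Fin m → Vector ℚ n) i I → (c i ∧ ⋀ c) I ≡ 0ℚ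
∧⋀-repeated c zero    I = ∧-alternating (c zero) (⋀ (tail c)) I
∧⋀-repeated c (suc i) I = trans (∧-anticomm (c (suc i)) (c zero) (⋀ (tail c)) I)
  (cong -_ (∧-zeroʳ (c zero) _ (∧⋀-repeated (tail c) i) I))

-- The sign is (-1)ⁱ, from moving column i past i others; only its absolute value is recorded, as
-- Cramer's rule serves for an estimate.
∧⋀-reinsert : ∀ {n m} (c : Fin (suc m) → Vector ℚ n) i →
              ∃ λ σ → ∣ σ ∣ ≡ 1ℚ × ∀ I → (c i ∧ ⋀ (c ∘ punchIn i)) I ≡ σ * ⋀ c I
∧⋀-reinsert             c zero    = 1ℚ , refl , λ I → sym (ℚ.*-identityˡ _)
∧⋀-reinsert {m = suc m} c (suc i) with ∧⋀-reinsert (tail c) i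
... | σ , ∣σ∣≡1 , eq = - σ , trans (ℚ.∣-p∣≡∣p∣ σ) ∣σ∣≡1 , λ I → begin
  (c (suc i) ∧ c zero ∧ ⋀ (tail c ∘ punchIn i)) I
    ≡⟨ ∧-anticomm (c (suc i)) (c zero) _ I ⟩
  - (c zero ∧ c (suc i) ∧ ⋀ (tail c ∘ punchIn i)) I
    ≡⟨ cong -_ (∧-cong (λ _ → refl) eq I) ⟩
  - (c zero ∧ λ J → σ * ⋀ (tail c) J) I
    ≡⟨ cong -_ (∧-scaleʳ (c zero) σ (⋀ (tail c)) I) ⟩
  - (σ * ⋀ c I)
    ≡⟨ ℚ.neg-distribˡ-* σ (⋀ c I) ⟩
  - σ * ⋀ c I ∎
  where open ≡-Reasoning

-- Expand b in the columns and wedge it with all columns but the i-th: every term except that of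
-- column i repeats a column and vanishes.
cramer : ∀ {n m} (c : Fin (suc m) → Vector ℚ n) (v : Vector ℚ (suc m)) (b : Vector ℚ n) →
         (∀ k → b k ≡ sum λ j → v j * c j k) →
         ∀ i I → ∣ v i * ⋀ c I ∣ ≡ ∣ (b ∧ ⋀ (c ∘ punchIn i)) I ∣
cramer c v b b≡Σvc i I with ∧⋀-reinsert c i
... | σ , ∣σ∣≡1 , eq = begin
  ∣ v i * ⋀ c I ∣             ≡⟨ ℚ.*-identityˡ _ ⟨
  1ℚ * ∣ v i * ⋀ c I ∣        ≡⟨ cong (_* ∣ v i * ⋀ c I ∣) ∣σ∣≡1 ⟨
  ∣ σ ∣ * ∣ v i * ⋀ c I ∣     ≡⟨ ℚ.∣p*q∣≡∣p∣*∣q∣ σ _ ⟨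
  ∣ σ * (v i * ⋀ c I) ∣       ≡⟨ cong ∣_∣ (swap σ (v i) (⋀ c I)) ⟩
  ∣ v i * (σ * ⋀ c I) ∣       ≡⟨ cong (λ z → ∣ v i * z ∣) (eq I) ⟨
  ∣ v i * (c i ∧ ω) I ∣       ≡⟨ cong ∣_∣ wedge ⟨
  ∣ (b ∧ ω) I ∣               ∎
  where
  open ≡-Reasoning
  swap = solve 3 (λ s a b → s :* (a :* b) := a :* (s :* b)) refl
  d = c ∘ punchIn i
  ω = ⋀ d
  rest : Vector ℚ _
  rest k = sum λ j → v (punchIn i j) * d j k
  wedge : (b ∧ ω) I ≡ v i * (c i ∧ ω) I
  wedge = begin
    (b ∧ ω) I
      ≡⟨ ∧-cong (λ k → trans (b≡Σvc k) (sum-remove {i = i} (λ j → v j * c j k))) (λ _ → refl) I ⟩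
    ((λ k → v i * c i k + rest k) ∧ ω) I
      ≡⟨ ∧-linearˡ (v i) (c i) rest ω I ⟩
    v i * (c i ∧ ω) I + (rest ∧ ω) I
      ≡⟨ cong (λ z → v i * (c i ∧ ω) I + z) (∧-sumˡ (v ∘ punchIn i) d ω I) ⟩
    v i * (c i ∧ ω) I + sum (λ j → v (punchIn i j) * (d j ∧ ω) I)
      ≡⟨ cong (λ z → v i * (c i ∧ ω) I + z) (sum-zero _ λ j →
           trans (cong (v (punchIn i j) *_) (∧⋀-repeated d j I)) (ℚ.*-zeroʳ (v (punchIn i j)))) ⟩
    v i * (c i ∧ ω) I + 0ℚ
      ≡⟨ ℚ.+-identityʳ _ ⟩
    v i * (c i ∧ ω) I ∎

-- Integer polynomial functions

evalPoly : ∀ {d} → Vec ℤ d → ℚ → ℚ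
evalPoly []       q = 0ℚ
evalPoly (c ∷ cs) q = ι c + q * evalPoly cs q

evalMonicℚ : ∀ {d} → Vec ℤ d → ℚ → ℚ
evalMonicℚ []       q = 1ℚ
evalMonicℚ (c ∷ cs) q = ι c + q * evalMonicℚ cs q

-- The degree is less than d.
Poly : ℕ → (ℚ → ℚ) → Set
Poly d f = ∃ λ (c : Vec ℤ d) → ∀ q → f q ≡ evalPoly c q

Monic : ℕ → (ℚ → ℚ) → Set
Monic d f = ∃ λ (c : Vec ℤ d) → ∀ q → f q ≡ evalMonicℚ c q

ι-0+ : ∀ p → ι (+ 0) + p ≡ p
ι-0+ p = trans (cong (_+ p) ι-0) (ℚ.+-identityˡ p)

private
  horner-+ = solve 5 (λ a b q x y → (a :+ b) :+ q :* (x :+ y) := (a :+ q :* x) :+ (b :+ q :* y)) refl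
  horner-* = solve 4 (λ z a q x → z :* a :+ q :* (z :* x) := z :* (a :+ q :* x)) refl

Poly-+ : ∀ {d f g} → Poly d f → Poly d g → Poly d (λ q → f q + g q)
Poly-+ (b , f≗b) (c , g≗c) = add b c , λ q → trans (cong₂ _+_ (f≗b q) (g≗c q)) (sym (add-eval b c q))
  where
  add : ∀ {d} → Vec ℤ d → Vec ℤ d → Vec ℤ d
  add []       []       = []
  add (b ∷ bs) (c ∷ cs) = b ℤ.+ c ∷ add bs cs
  add-eval : ∀ {d} (b c : Vec ℤ d) q → evalPoly (add b c) q ≡ evalPoly b q + evalPoly c q
  add-eval []       []       q = refl
  add-eval (b ∷ bs) (c ∷ cs) q
    rewrite ι-+ b c | add-eval bs cs q = horner-+ (ι b) (ι c) q (evalPoly bs q) (evalPoly cs q)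

Poly-scale : ∀ {d f} z → Poly d f → Poly d (λ q → ι z * f q)
Poly-scale z (c , f≗c) = scale c , λ q → trans (cong (ι z *_) (f≗c q)) (sym (scale-eval c q))
  where
  scale : ∀ {d} → Vec ℤ d → Vec ℤ d
  scale []       = []
  scale (c ∷ cs) = z ℤ.* c ∷ scale cs
  scale-eval : ∀ {d} (c : Vec ℤ d) q → evalPoly (scale c) q ≡ ι z * evalPoly c q
  scale-eval []       q = sym (ℚ.*-zeroʳ (ι z))
  scale-eval (c ∷ cs) q rewrite ι-* z c | scale-eval cs q = horner-* (ι z) (ι c) q (evalPoly cs q)

Poly-cong : ∀ {d f g} → (∀ q → f q ≡ g q) → Poly d g → Poly d f
Poly-cong f≗g (c , g≗c) = c , λ q → trans (f≗g q) (g≗c q)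

Poly-- : ∀ {d f g} → Poly d f → Poly d g → Poly d (λ q → f q - g q)
Poly-- {f = f} {g} P Q = Poly-cong
  (λ q → trans (solve 2 (λ a b → a :- b := a :+ (:- con 1ℚ) :* b) refl (f q) (g q))
    (cong (λ z → f q + z * g q) (sym (trans (ι-neg (+ 1)) (cong -_ ι-1)))))
  (Poly-+ P (Poly-scale (ℤ.- + 1) Q))

Poly-zero : ∀ {d} → Poly d (λ _ → 0ℚ)
Poly-zero {d} = zeros d , λ q → sym (zeros-eval d q)
  where
  zeros : ∀ d → Vec ℤ d
  zeros zero    = []
  zeros (suc d) = + 0 ∷ zeros d
  zeros-eval : ∀ d q → evalPoly (zeros d) q ≡ 0ℚ
  zeros-eval zero    q = refl
  zeros-eval (suc d) q rewrite zeros-eval d q | ι-0 = trans (ℚ.+-identityˡ _) (ℚ.*-zeroʳ q)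

Poly-const : ∀ {d} z → Poly (suc d) (λ _ → ι z)
Poly-const z with Poly-zero
... | c , 0≗c = z ∷ c , λ q → sym (trans (cong (λ x → ι z + q * x) (sym (0≗c q)))
  (trans (cong (λ x → ι z + x) (ℚ.*-zeroʳ q)) (ℚ.+-identityʳ (ι z))))

Poly-shift : ∀ {d f} → Poly d f → Poly (suc d) (λ q → q * f q)
Poly-shift (c , f≗c) = + 0 ∷ c , λ q → trans (cong (q *_) (f≗c q)) (sym (ι-0+ _))

Poly-weaken : ∀ {d f} → Poly d f → Poly (suc d) f
Poly-weaken (c , f≗c) = extend c , λ q → trans (f≗c q) (sym (extend-eval c q))
  where
  extend : ∀ {d} → Vec ℤ d → Vec ℤ (suc d)
  extend []       = + 0 ∷ []
  extend (c ∷ cs) = c ∷ extend cs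
  extend-eval : ∀ {d} (c : Vec ℤ d) q → evalPoly (extend c) q ≡ evalPoly c q
  extend-eval []       q = trans (ι-0+ _) (ℚ.*-zeroʳ q)
  extend-eval (c ∷ cs) q = cong (λ x → ι c + q * x) (extend-eval cs q)

-- The summand `g` has degree below d and leaves the leading coefficient alone.
Monic-+ : ∀ {d f g} → Monic d f → Poly d g → Monic d (λ q → f q + g q)
Monic-+ (b , f≗b) (c , g≗c) = add b c , λ q → trans (cong₂ _+_ (f≗b q) (g≗c q)) (sym (add-eval b c q))
  where
  add : ∀ {d} → Vec ℤ d → Vec ℤ d → Vec ℤ d
  add []       []       = []
  add (b ∷ bs) (c ∷ cs) = b ℤ.+ c ∷ add bs cs
  add-eval : ∀ {d} (b c : Vec ℤ d) q → evalMonicℚ (add b c) q ≡ evalMonicℚ b q + evalPoly c q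
  add-eval []       []       q = sym (ℚ.+-identityʳ 1ℚ)
  add-eval (b ∷ bs) (c ∷ cs) q
    rewrite ι-+ b c | add-eval bs cs q = horner-+ (ι b) (ι c) q (evalMonicℚ bs q) (evalPoly cs q)

Monic-shift : ∀ {d f} → Monic d f → Monic (suc d) (λ q → q * f q)
Monic-shift (c , f≗c) = + 0 ∷ c , λ q → trans (cong (q *_) (f≗c q)) (sym (ι-0+ _))

Monic-cong : ∀ {d f g} → (∀ q → f q ≡ g q) → Monic d g → Monic d f
Monic-cong f≗g (c , g≗c) = c , λ q → trans (f≗g q) (g≗c q)

Monic⇒Poly : ∀ {d f} → Monic d f → Poly (suc d) f
Monic⇒Poly (c , f≗c) = extend c , λ q → trans (f≗c q) (sym (extend-eval c q))
  where
  extend : ∀ {d} → Vec ℤ d → Vec ℤ (suc d)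
  extend []       = + 1 ∷ []
  extend (c ∷ cs) = c ∷ extend cs
  extend-eval : ∀ {d} (c : Vec ℤ d) q → evalPoly (extend c) q ≡ evalMonicℚ c q
  extend-eval []       q = trans (cong₂ _+_ ι-1 (ℚ.*-zeroʳ q)) (ℚ.+-identityʳ 1ℚ)
  extend-eval (c ∷ cs) q = cong (λ x → ι c + q * x) (extend-eval cs q)

Poly-bounded : ∀ {d f} → Poly d f → ∀ B → 0ℚ ≤ B →
               ∃ λ K → 0ℚ ≤ K × ∀ q → 0ℚ ≤ q → q ≤ B → ∣ f q ∣ ≤ K
Poly-bounded {d} {f} (c , f≗c) B 0≤B = bound c , 0≤bound c ,
  λ q 0≤q q≤B → subst (λ z → ∣ z ∣ ≤ bound c) (sym (f≗c q)) (bounded c q 0≤q q≤B)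
  where
  bound : ∀ {d} → Vec ℤ d → ℚ
  bound []       = 0ℚ
  bound (c ∷ cs) = ∣ ι c ∣ + B * bound cs
  0≤bound : ∀ {d} (c : Vec ℤ d) → 0ℚ ≤ bound c
  0≤bound []       = ℚ.≤-refl
  0≤bound (c ∷ cs) = 0≤+ (ℚ.0≤∣p∣ (ι c)) (0≤* 0≤B (0≤bound cs))
  bounded : ∀ {d} (c : Vec ℤ d) q → 0ℚ ≤ q → q ≤ B → ∣ evalPoly c q ∣ ≤ bound c
  bounded []       q 0≤q q≤B = ℚ.≤-refl
  bounded (c ∷ cs) q 0≤q q≤B = begin
    ∣ ι c + q * evalPoly cs q ∣         ≤⟨ ℚ.∣p+q∣≤∣p∣+∣q∣ (ι c) _ ⟩
    ∣ ι c ∣ + ∣ q * evalPoly cs q ∣     ≡⟨ cong (λ z → ∣ ι c ∣ + z) (ℚ.∣p*q∣≡∣p∣*∣q∣ q _) ⟩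
    ∣ ι c ∣ + ∣ q ∣ * ∣ evalPoly cs q ∣ ≡⟨ cong (λ z → ∣ ι c ∣ + z * ∣ evalPoly cs q ∣) (ℚ.0≤p⇒∣p∣≡p 0≤q) ⟩
    ∣ ι c ∣ + q * ∣ evalPoly cs q ∣     ≤⟨ ℚ.+-monoʳ-≤ ∣ ι c ∣
      (*-mono-≤ 0≤q (0≤bound cs) q≤B (bounded cs q 0≤q q≤B)) ⟩
    ∣ ι c ∣ + B * bound cs              ∎
    where open ℚ.≤-Reasoning

-- Characteristic polynomials

-- The hypothesis concerns multiplication by entries of `v`, so that one lemma covers entries of
-- degree 1 (e = d + 1) and entries constant in q (e = d).
∧-poly : ∀ {n d e} {v : ℚ → Vector ℚ n} {ω : ℚ → Form n} →
         (∀ i {g} → Poly d g → Poly e (λ q → v q i * g q)) →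
         (∀ I → Poly d (λ q → ω q I)) → ∀ I → Poly e (λ q → (v q ∧ ω q) I)
∧-poly v* ωP []          = Poly-zero
∧-poly v* ωP (false ∷ I) = ∧-poly (v* ∘ suc) (ωP ∘ (false ∷_)) I
∧-poly v* ωP (true ∷ I)  =
  Poly-- (v* zero (ωP (false ∷ I))) (∧-poly (v* ∘ suc) (ωP ∘ (true ∷_)) I)

unit-poly : ∀ {n d} I → Poly (suc d) (λ q → unit {n} I)
unit-poly []          = Poly-cong (λ _ → sym ι-1) (Poly-const (+ 1))
unit-poly (false ∷ I) = unit-poly I
unit-poly (true ∷ I)  = Poly-zero

⋀-poly : ∀ {n m} {c : ℚ → Fin m → Vector ℚ n} →
         (∀ j i {d g} → Poly d g → Poly (suc d) (λ q → c q j i * g q)) →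
         ∀ I → Poly (suc m) (λ q → ⋀ (c q) I)
⋀-poly {m = zero}  c* = unit-poly
⋀-poly {m = suc m} c* = ∧-poly (λ i → c* zero i) (⋀-poly (c* ∘ suc))

-- Kronecker's delta, with values in ℕ because it serves both for the identity in q - A and for
-- counting transitions between windows.
δ : ∀ {n} → Fin n → Fin n → ℕ
δ zero    zero    = 1
δ zero    (suc j) = 0
δ (suc i) zero    = 0
δ (suc i) (suc j) = δ i j

Matrix : Set → ℕ → Set
Matrix X n = Fin n → Fin n → X

charColumns : ∀ {n} → Matrix ℤ n → ℚ → Fin n → Vector ℚ n
charColumns A q j i = q * ι (+ δ i j) - ι (A i j)

charColumns-poly : ∀ {n} (A : Matrix ℤ n) j i {d g} → Poly d g →
                   Poly (suc d) (λ q → charColumns A q j i * g q)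
charColumns-poly A j i {g = g} P = Poly-cong
  (λ q → solve 4 (λ q d a x → (q :* d :- a) :* x := q :* (d :* x) :- a :* x) refl
    q (ι (+ δ i j)) (ι (A i j)) (g q))
  (Poly-- (Poly-shift (Poly-scale (+ δ i j) P)) (Poly-weaken (Poly-scale (A i j) P)))

full : ∀ n → Vec Bool n
full zero    = []
full (suc n) = true ∷ full n

-- The determinant of q - A, as the coefficient of the volume form in the wedge of its columns.
charPoly : ∀ {n} → Matrix ℤ n → ℚ → ℚ
charPoly A q = ⋀ (charColumns A q) (full _)

charPoly-monic : ∀ {n} (A : Matrix ℤ n) → Monic n (charPoly A)
charPoly-monic {zero}  A = [] , λ _ → refl
charPoly-monic {suc n} A = Monic-cong expand
  (Monic-+ (Monic-shift minorMonic)
    (Poly-- (Poly-scale (ℤ.- A zero zero) (Monic⇒Poly minorMonic)) lowerPoly))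
  where
  minor : Matrix ℤ n
  minor i j = A (suc i) (suc j)
  minorMonic = charPoly-monic minor
  -- The contribution of the off-diagonal entries of the zeroth column. They are constant in q, and
  -- the n other columns contribute degree at most n, so the power n + 1 comes only from q times the
  -- minor.
  lower : ℚ → ℚ
  lower q = (tail (charColumns A q zero) ∧ λ J → ⋀ (tail (charColumns A q)) (true ∷ J)) (full n)
  lowerPoly : Poly (suc n) lower
  lowerPoly = ∧-poly {d = suc n}
    (λ i {g} P → Poly-cong
      (λ q → trans (cong (λ z → (q * z - ι (A (suc i) zero)) * g q) ι-0) (trans
        (solve 3 (λ q a x → (q :* con 0ℚ :- a) :* x := (:- a) :* x) refl q (ι (A (suc i) zero)) (g q))
        (cong (_* g q) (sym (ι-neg (A (suc i) zero))))))
      (Poly-scale (ℤ.- A (suc i) zero) P))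
    (λ J → ⋀-poly (λ j → charColumns-poly A (suc j)) (true ∷ J)) (full n)
  expand : ∀ q → charPoly A q ≡ q * charPoly minor q + (ι (ℤ.- A zero zero) * charPoly minor q - lower q)
  expand q = trans
    (cong (λ z → charColumns A q zero zero * z - lower q) (⋀-restrict (tail (charColumns A q)) (full n)))
    (trans (cong (λ z → (q * z - ι (A zero zero)) * charPoly minor q - lower q) ι-1) (trans
      (solve 4 (λ q a p l → (q :* con 1ℚ :- a) :* p :- l := q :* p :+ ((:- a) :* p :- l)) refl
        q (ι (A zero zero)) (charPoly minor q) (lower q))
      (cong (λ z → q * charPoly minor q + (z * charPoly minor q - lower q)) (sym (ι-neg (A zero zero))))))

-- Nonnegative matrices and linear inequalities

_·_ : ∀ {n} → Matrix ℚ n → Vector ℚ n → Vector ℚ n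
(A · v) i = sum λ j → A i j * v j

·-mono : ∀ {n} {A : Matrix ℚ n} → (∀ i j → 0ℚ ≤ A i j) →
         ∀ {v w} → (∀ j → v j ≤ w j) → ∀ i → (A · v) i ≤ (A · w) i
·-mono 0≤A v≤w i = sum-mono λ j → *-monoˡ (0≤A i j) (v≤w j)

0≤· : ∀ {n} {A : Matrix ℚ n} → (∀ i j → 0ℚ ≤ A i j) →
      ∀ {v} → (∀ j → 0ℚ ≤ v j) → ∀ i → 0ℚ ≤ (A · v) i
0≤· 0≤A 0≤v i = 0≤sum λ j → 0≤* (0≤A i j) (0≤v j)

·-scale : ∀ {n} (A : Matrix ℚ n) t v i → (A · λ j → t * v j) i ≡ t * (A · v) i
·-scale A t v i = trans
  (sum-cong-≗ λ j → solve 3 (λ a t x → a :* (t :* x) := t :* (a :* x)) refl (A i j) t (v j))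
  (sym (*-distribˡ-sum t (λ j → A i j * v j)))

·-linear : ∀ {n} (A : Matrix ℚ n) t u v i → (A · λ j → t * u j - v j) i ≡ t * (A · u) i - (A · v) i
·-linear A t u v i = begin
  sum (λ j → A i j * (t * u j - v j))
    ≡⟨ sum-cong-≗ (λ j → solve 4 (λ a t x y → a :* (t :* x :- y) := a :* (t :* x) :+ con (- 1ℚ) :* (a :* y))
         refl (A i j) t (u j) (v j)) ⟩
  sum (λ j → A i j * (t * u j) + - 1ℚ * (A i j * v j))
    ≡⟨ ∑-distrib-+ (λ j → A i j * (t * u j)) (λ j → - 1ℚ * (A i j * v j)) ⟩
  sum (λ j → A i j * (t * u j)) + sum (λ j → - 1ℚ * (A i j * v j))
    ≡⟨ cong₂ _+_ (·-scale A t u i) (sym (*-distribˡ-sum (- 1ℚ) (λ j → A i j * v j))) ⟩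
  t * (A · u) i + - 1ℚ * (A · v) i
    ≡⟨ solve 2 (λ x y → x :+ con (- 1ℚ) :* y := x :- y) refl (t * (A · u) i) ((A · v) i) ⟩
  t * (A · u) i - (A · v) i ∎
  where open ≡-Reasoning

-- For nonnegative A this says that q - A is a nonsingular M-matrix. Uniqueness of solutions is
-- contained in `inversePositive`, applied to a vector and its negative.
record Subcritical {n} (A : Matrix ℚ n) (q : ℚ) : Set where
  field
    resolvent : ∀ (b : Vector ℚ n) → (∀ i → 0ℚ ≤ b i) →
                ∃ λ (v : Vector ℚ n) → (∀ i → 0ℚ ≤ v i) × ∀ i → q * v i ≡ (A · v) i + b i
    inversePositive : ∀ (x : Vector ℚ n) → (∀ i → (A · x) i ≤ q * x i) → ∀ i → 0ℚ ≤ x i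

open Subcritical

-- A Collatz-Wielandt certificate that q is at most the spectral radius. Being nonzero is expressed
-- by a positive sum, the quantity by which later estimates divide.
Supercritical : ∀ {n} → Matrix ℚ n → ℚ → Set
Supercritical A q = ∃ λ (w : Vector ℚ _) → (∀ i → 0ℚ ≤ w i) × 0ℚ < sum w × ∀ i → q * w i ≤ (A · w) i

module Elimination {n} (A : Matrix ℚ (suc n)) (q g : ℚ)
  (0≤A : ∀ i j → 0ℚ ≤ A i j) (0<g : 0ℚ < g) (pivot : (q - A zero zero) * g ≡ 1ℚ) where

  α : ℚ
  α = A zero zero

  row col : Vector ℚ n
  row j = A zero (suc j)
  col i = A (suc i) zero

  -- q - `schur` is the Schur complement of the pivot q - α in q - A. Since the pivot is positive,
  -- `schur` is again nonnegative, and the same q can be tested in one dimension less.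
  schur : Matrix ℚ n
  schur i j = A (suc i) (suc j) + col i * (g * row j)

  0≤g : 0ℚ ≤ g
  0≤g = ℚ.<⇒≤ 0<g

  0≤schur : ∀ i j → 0ℚ ≤ schur i j
  0≤schur i j = 0≤+ (0≤A (suc i) (suc j)) (0≤* (0≤A (suc i) zero) (0≤* 0≤g (0≤A zero (suc j))))

  0<q-α : 0ℚ < q - α
  0<q-α = ℚ.*-cancelʳ-<-nonNeg g {{nonNegative 0≤g}}
    (subst₂ _<_ (sym (ℚ.*-zeroˡ g)) (sym pivot) 0<1)

  rowSum : Vector ℚ n → ℚ
  rowSum v = sum λ j → row j * v j

  rest : Vector ℚ n → Vector ℚ n
  rest v i = sum λ j → A (suc i) (suc j) * v j

  schur-· : ∀ v i → (schur · v) i ≡ col i * (g * rowSum v) + rest v i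
  schur-· v i = begin
    sum (λ j → schur i j * v j)
      ≡⟨ sum-cong-≗ (λ j → solve 5 (λ a c g r x → (a :+ c :* (g :* r)) :* x := (c :* g) :* (r :* x) :+ a :* x)
           refl (A (suc i) (suc j)) (col i) g (row j) (v j)) ⟩
    sum (λ j → (col i * g) * (row j * v j) + A (suc i) (suc j) * v j)
      ≡⟨ ∑-distrib-+ (λ j → (col i * g) * (row j * v j)) _ ⟩
    sum (λ j → (col i * g) * (row j * v j)) + rest v i
      ≡⟨ cong (_+ rest v i) (sym (*-distribˡ-sum (col i * g) (λ j → row j * v j))) ⟩
    (col i * g) * rowSum v + rest v i
      ≡⟨ cong (_+ rest v i) (ℚ.*-assoc (col i) g (rowSum v)) ⟩
    col i * (g * rowSum v) + rest v i ∎
    where open ≡-Reasoning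

  pivot* : ∀ x → (q - α) * (g * x) ≡ x
  pivot* x = trans (sym (ℚ.*-assoc (q - α) g x)) (trans (cong (_* x) pivot) (ℚ.*-identityˡ x))

  extend : ℚ → Vector ℚ n → Vector ℚ (suc n)
  extend x v zero    = x
  extend x v (suc i) = v i

  subcritical : Subcritical schur q → Subcritical A q
  subcritical sub .resolvent b 0≤b = extend x v , 0≤xv , eq
    where
    b′ : Vector ℚ n
    b′ i = b (suc i) + col i * (g * b zero)
    solution = resolvent sub b′
      λ i → 0≤+ (0≤b (suc i)) (0≤* (0≤A (suc i) zero) (0≤* 0≤g (0≤b zero)))
    v = proj₁ solution
    x = g * (rowSum v + b zero)
    0≤xv : ∀ i → 0ℚ ≤ extend x v i
    0≤xv zero    = 0≤* 0≤g (0≤+ (0≤sum λ j → 0≤* (0≤A zero (suc j)) (proj₁ (proj₂ solution) j)) (0≤b zero))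
    0≤xv (suc i) = proj₁ (proj₂ solution) i
    eq : ∀ i → q * extend x v i ≡ (A · extend x v) i + b i
    eq zero    = begin
      q * x                           ≡⟨ solve 3 (λ q a x → q :* x := a :* x :+ (q :- a) :* x) refl q α x ⟩
      α * x + (q - α) * x             ≡⟨ cong (λ z → α * x + z) (pivot* (rowSum v + b zero)) ⟩
      α * x + (rowSum v + b zero)     ≡⟨ ℚ.+-assoc (α * x) (rowSum v) (b zero) ⟨
      α * x + rowSum v + b zero       ∎
      where open ≡-Reasoning
    eq (suc i) = begin
      q * v i
        ≡⟨ proj₂ (proj₂ solution) i ⟩
      (schur · v) i + b′ i
        ≡⟨ cong (_+ b′ i) (schur-· v i) ⟩
      col i * (g * rowSum v) + rest v i + b′ i
        ≡⟨ solve 6 (λ c g r s b b₀ → c :* (g :* r) :+ s :+ (b :+ c :* (g :* b₀)) := c :* (g :* (r :+ b₀)) :+ s :+ b)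
             refl (col i) g (rowSum v) (rest v i) (b (suc i)) (b zero) ⟩
      col i * x + rest v i + b (suc i) ∎
      where open ≡-Reasoning
  subcritical sub .inversePositive x Ax≤qx = 0≤x
    where
    y = tail x
    -- The zeroth inequality bounds x₀ from below by the rest. Inserted into the other inequalities
    -- it gives `schur` · y ≤ q y, so y is nonnegative, and then x₀ is.
    gRy≤x₀ : g * rowSum y ≤ x zero
    gRy≤x₀ = *-cancelˡ-≤ 0<q-α (subst₂ _≤_ (sym (pivot* (rowSum y)))
      (solve 3 (λ q a x → q :* x :- a :* x := (q :- a) :* x) refl q α (x zero))
      (+-cancelʳ (α * x zero) (subst₂ _≤_
        (ℚ.+-comm (α * x zero) (rowSum y))
        (solve 2 (λ a b → a := a :- b :+ b) refl (q * x zero) (α * x zero))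
        (Ax≤qx zero))))
    0≤y : ∀ i → 0ℚ ≤ y i
    0≤y = inversePositive sub y λ i → ℚ.≤-trans (ℚ.≤-reflexive (schur-· y i))
      (ℚ.≤-trans (ℚ.+-monoˡ-≤ (rest y i) (*-monoˡ (0≤A (suc i) zero) gRy≤x₀)) (Ax≤qx (suc i)))
    0≤x : ∀ i → 0ℚ ≤ x i
    0≤x zero    = ℚ.≤-trans (0≤* 0≤g (0≤sum λ j → 0≤* (0≤A zero (suc j)) (0≤y j))) gRy≤x₀
    0≤x (suc i) = 0≤y i

  supercritical : Supercritical schur q → Supercritical A q
  supercritical (w , 0≤w , 0<Σw , qw≤) = extend x w , 0≤xw , ℚ.<-≤-trans 0<Σw (p≤q+p 0≤x) , ineq
    where
    -- This choice turns the zeroth inequality into an equality.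
    x = g * rowSum w
    0≤x : 0ℚ ≤ x
    0≤x = 0≤* 0≤g (0≤sum λ j → 0≤* (0≤A zero (suc j)) (0≤w j))
    0≤xw : ∀ i → 0ℚ ≤ extend x w i
    0≤xw zero    = 0≤x
    0≤xw (suc i) = 0≤w i
    ineq : ∀ i → q * extend x w i ≤ (A · extend x w) i
    ineq zero    = ℚ.≤-reflexive (trans
      (solve 3 (λ q a x → q :* x := a :* x :+ (q :- a) :* x) refl q α x)
      (cong (λ z → α * x + z) (pivot* (rowSum w))))
    ineq (suc i) = ℚ.≤-trans (qw≤ i) (ℚ.≤-reflexive (schur-· w i))

basis₀ : ∀ {n} → Vector ℚ (suc n)
basis₀ zero    = 1ℚ
basis₀ (suc i) = 0ℚ

dichotomy : ∀ {n} (A : Matrix ℚ n) → (∀ i j → 0ℚ ≤ A i j) →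
            ∀ q → Supercritical A q ⊎ Subcritical A q
dichotomy {zero}  A 0≤A q = inj₂ record
  { resolvent = λ b _ → b , (λ ()) , λ () ; inversePositive = λ _ _ () }
dichotomy {suc n} A 0≤A q with q ℚ.≤? A zero zero
-- No positive pivot: e₀ is itself a certificate, because A e₀ has zeroth entry α ≥ q and is
-- nonnegative elsewhere.
... | yes q≤α = inj₁ (basis₀ , 0≤basis₀ , ℚ.<-≤-trans 0<1 (p≤p+q (0≤sum {n} λ i → 0≤basis₀ (suc i))) , ineq)
  where
  0≤basis₀ : ∀ {n} (i : Fin (suc n)) → 0ℚ ≤ basis₀ i
  0≤basis₀ zero    = 0≤1
  0≤basis₀ (suc i) = ℚ.≤-refl
  ineq : ∀ i → q * basis₀ i ≤ (A · basis₀) i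
  ineq zero    = ℚ.≤-trans (*-monoʳ 0≤1 q≤α)
    (p≤p+q (0≤sum {n} λ j → 0≤* (0≤A zero (suc j)) ℚ.≤-refl))
  ineq (suc i) = ℚ.≤-trans (ℚ.≤-reflexive (ℚ.*-zeroʳ q)) (0≤· 0≤A 0≤basis₀ (suc i))
... | no q≰α with inverse (0<q-p (ℚ.≰⇒> q≰α))
... | g , 0<g , pivot with dichotomy (Elimination.schur A q g 0≤A 0<g pivot) (Elimination.0≤schur A q g 0≤A 0<g pivot) q
... | inj₁ super = inj₁ (Elimination.supercritical A q g 0≤A 0<g pivot super)
... | inj₂ sub   = inj₂ (Elimination.subcritical A q g 0≤A 0<g pivot sub)

-- If q ≤ p, then A(-w) ≤ -p w ≤ q(-w), so -w would be nonnegative and w would vanish.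
super<sub : ∀ {n} (A : Matrix ℚ n) → (∀ i j → 0ℚ ≤ A i j) →
            ∀ {p q} → Supercritical A p → Subcritical A q → p < q
super<sub A 0≤A {p} {q} (w , 0≤w , 0<Σw , pw≤Aw) sub with q ℚ.≤? p
... | no q≰p  = ℚ.≰⇒> q≰p
... | yes q≤p = contradiction (subst (0ℚ <_) (sum-zero w w≡0) 0<Σw) (ℚ.<-irrefl refl)
  where
  -w : Vector ℚ _
  -w i = - 1ℚ * w i
  0≤-w : ∀ i → 0ℚ ≤ -w i
  0≤-w = inversePositive sub -w λ i → begin
    (A · -w) i        ≡⟨ ·-scale A (- 1ℚ) w i ⟩
    - 1ℚ * (A · w) i  ≤⟨ ℚ.*-monoˡ-≤-nonPos (- 1ℚ) (ℚ.≤-trans (*-monoʳ (0≤w i) q≤p) (pw≤Aw i)) ⟩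
    - 1ℚ * (q * w i)  ≡⟨ solve 2 (λ q x → con (- 1ℚ) :* (q :* x) := q :* (con (- 1ℚ) :* x)) refl q (w i) ⟩
    q * -w i          ∎
    where open ℚ.≤-Reasoning
  w≡0 : ∀ i → w i ≡ 0ℚ
  w≡0 i = ℚ.≤-antisym
    (subst₂ _≤_ (ℚ.+-identityʳ (w i))
      (solve 1 (λ x → x :+ con (- 1ℚ) :* x := con 0ℚ) refl (w i))
      (ℚ.+-monoʳ-≤ (w i) (0≤-w i)))
    (0≤w i)

-- Spectral properties of a nonnegative integer matrix

toℤ : ∀ {n} → Matrix ℕ n → Matrix ℤ n
toℤ N i j = + N i j

toℚ : ∀ {n} → Matrix ℕ n → Matrix ℚ n
toℚ N i j = ι (+ N i j)

0≤toℚ : ∀ {n} (N : Matrix ℕ n) i j → 0ℚ ≤ toℚ N i j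
0≤toℚ N i j = 0≤ι (N i j)

sum-δ : ∀ {n} (v : Vector ℚ n) k → sum (λ j → v j * ι (+ δ k j)) ≡ v k
sum-δ v zero    = trans
  (cong₂ _+_ (trans (cong (v zero *_) ι-1) (ℚ.*-identityʳ (v zero)))
    (sum-zero _ λ j → trans (cong (v (suc j) *_) ι-0) (ℚ.*-zeroʳ (v (suc j)))))
  (ℚ.+-identityʳ (v zero))
sum-δ v (suc k) = trans
  (cong₂ _+_ (trans (cong (v zero *_) ι-0) (ℚ.*-zeroʳ (v zero))) (sum-δ (tail v) k))
  (ℚ.+-identityˡ (v (suc k)))

charColumns-· : ∀ {n} (N : Matrix ℕ n) q v k →
                sum (λ j → v j * charColumns (toℤ N) q j k) ≡ q * v k - (toℚ N · v) k
charColumns-· N q v k = begin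
  sum (λ j → v j * (q * ι (+ δ k j) - toℚ N k j))
    ≡⟨ sum-cong-≗ (λ j → solve 4 (λ x q d a → x :* (q :* d :- a) := q :* (x :* d) :+ con (- 1ℚ) :* (a :* x))
         refl (v j) q (ι (+ δ k j)) (toℚ N k j)) ⟩
  sum (λ j → q * (v j * ι (+ δ k j)) + - 1ℚ * (toℚ N k j * v j))
    ≡⟨ ∑-distrib-+ (λ j → q * (v j * ι (+ δ k j))) _ ⟩
  sum (λ j → q * (v j * ι (+ δ k j))) + sum (λ j → - 1ℚ * (toℚ N k j * v j))
    ≡⟨ cong₂ _+_ (*-distribˡ-sum q (λ j → v j * ι (+ δ k j)))
                 (*-distribˡ-sum (- 1ℚ) (λ j → toℚ N k j * v j)) ⟨
  q * sum (λ j → v j * ι (+ δ k j)) + - 1ℚ * (toℚ N · v) k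
    ≡⟨ cong (λ z → q * z + - 1ℚ * (toℚ N · v) k) (sum-δ v k) ⟩
  q * v k + - 1ℚ * (toℚ N · v) k
    ≡⟨ solve 2 (λ x y → x :+ con (- 1ℚ) :* y := x :- y) refl (q * v k) ((toℚ N · v) k) ⟩
  q * v k - (toℚ N · v) k ∎
  where open ≡-Reasoning

-- By Cramer's rule charPoly(q) v is bounded for v = (q − A)⁻¹1, whereas a
-- supercritical p < q forces v to be of order 1/(q − p).
charPoly-small : ∀ {n} (N : Matrix ℕ n) B → 0ℚ ≤ B → ∃ λ K → 0ℚ ≤ K ×
                 ∀ {p q} → 0ℚ ≤ q → q ≤ B → Supercritical (toℚ N) p → Subcritical (toℚ N) q →
                 ∣ charPoly (toℤ N) q ∣ ≤ K * (q - p)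
charPoly-small {zero} N B 0≤B = 0ℚ , ℚ.≤-refl , λ _ _ (_ , _ , 0<0 , _) _ →
  contradiction 0<0 (ℚ.<-irrefl refl)
charPoly-small {suc m} N B 0≤B = sum K , 0≤sum (proj₁ ∘ proj₂ ∘ bound) , small
  where
  A = toℚ N
  -- The numerators in Cramer's rule for (q - A)v = 1, up to sign. They are polynomials in q alone,
  -- so their bound on [0, B] does not depend on p or q.
  minorForm : Fin (suc m) → ℚ → ℚ
  minorForm i q = ((λ _ → 1ℚ) ∧ ⋀ (charColumns (toℤ N) q ∘ punchIn i)) (full (suc m))
  minorPoly : ∀ i → Poly (suc m) (minorForm i)
  minorPoly i = ∧-poly {v = λ _ _ → 1ℚ} (λ _ {g} → Poly-cong λ q → ℚ.*-identityˡ (g q))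
    (⋀-poly {c = λ q → charColumns (toℤ N) q ∘ punchIn i}
      λ j → charColumns-poly (toℤ N) (punchIn i j)) (full (suc m))
  bound : ∀ i → ∃ λ K → 0ℚ ≤ K × ∀ q → 0ℚ ≤ q → q ≤ B → ∣ minorForm i q ∣ ≤ K
  bound i = Poly-bounded (minorPoly i) B 0≤B
  K : Vector ℚ (suc m)
  K i = proj₁ (bound i)
  small : ∀ {p q} → 0ℚ ≤ q → q ≤ B → Supercritical A p → Subcritical A q →
          ∣ charPoly (toℤ N) q ∣ ≤ sum K * (q - p)
  small {p} {q} 0≤q q≤B super@(w , 0≤w , 0<W , pw≤Aw) sub = *-cancelˡ-≤ {q = sum K * (q - p)} 0<W (begin
    W * P                             ≡⟨ ℚ.*-comm W P ⟩
    P * W                             ≡⟨ *-distribˡ-sum P w ⟩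
    sum (λ i → P * w i)               ≤⟨ sum-mono Pw≤ ⟩
    sum (λ i → t * K i)               ≡⟨ *-distribˡ-sum t K ⟨
    t * sum K                         ≡⟨ solve 3 (λ d W k → (d :* W) :* k := W :* (k :* d)) refl (q - p) W (sum K) ⟩
    W * (sum K * (q - p))             ∎)
    where
    open ℚ.≤-Reasoning
    P = ∣ charPoly (toℤ N) q ∣
    W = sum w
    0≤q-p′ : 0ℚ ≤ q - p
    0≤q-p′ = 0≤q-p (ℚ.<⇒≤ (super<sub A (0≤toℚ N) {p} {q} super sub))
    t = (q - p) * W
    0≤t : 0ℚ ≤ t
    0≤t = 0≤* 0≤q-p′ (ℚ.<⇒≤ 0<W)
    solution = resolvent sub (λ _ → 1ℚ) (λ _ → 0≤1)
    v = proj₁ solution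
    0≤v = proj₁ (proj₂ solution)
    qv≡Av+1 = proj₂ (proj₂ solution)
    -- Here (q - A)(t v) = t in every entry, while (q - A)w ≤ (q - p)w ≤ (q - p)W = t, as each entry
    -- of w is at most the sum W.
    0≤tv-w : ∀ i → 0ℚ ≤ t * v i - w i
    0≤tv-w = inversePositive sub (λ i → t * v i - w i) λ i → begin
      (A · λ j → t * v j - w j) i
        ≡⟨ ·-linear A t v w i ⟩
      t * (A · v) i - (A · w) i
        ≤⟨ ℚ.+-monoʳ-≤ (t * (A · v) i) (ℚ.neg-antimono-≤ (pw≤Aw i)) ⟩
      t * (A · v) i - p * w i
        ≡⟨ solve 5 (λ t a p q x → t :* a :- p :* x := t :* a :- q :* x :+ (q :- p) :* x)
             refl t ((A · v) i) p q (w i) ⟩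
      t * (A · v) i - q * w i + (q - p) * w i
        ≤⟨ ℚ.+-monoʳ-≤ (t * (A · v) i - q * w i) (*-monoˡ 0≤q-p′ (≤sum 0≤w i)) ⟩
      t * (A · v) i - q * w i + t
        ≡⟨ solve 3 (λ t a x → t :* a :- x :+ t := t :* (a :+ con 1ℚ) :- x) refl t ((A · v) i) (q * w i) ⟩
      t * ((A · v) i + 1ℚ) - q * w i
        ≡⟨ cong (λ z → t * z - q * w i) (qv≡Av+1 i) ⟨
      t * (q * v i) - q * w i
        ≡⟨ solve 4 (λ t q x y → t :* (q :* x) :- q :* y := q :* (t :* x :- y)) refl t q (v i) (w i) ⟩
      q * (t * v i - w i) ∎
    1≡Σvc : ∀ k → 1ℚ ≡ sum λ j → v j * charColumns (toℤ N) q j k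
    1≡Σvc k = sym (trans (charColumns-· N q v k)
      (trans (cong (_- (A · v) k) (qv≡Av+1 k))
        (solve 1 (λ a → a :+ con 1ℚ :- a := con 1ℚ) refl ((A · v) k))))
    vP≤K : ∀ i → v i * P ≤ K i
    vP≤K i = begin
      v i * P                             ≡⟨ cong (_* P) (ℚ.0≤p⇒∣p∣≡p (0≤v i)) ⟨
      ∣ v i ∣ * P                         ≡⟨ ℚ.∣p*q∣≡∣p∣*∣q∣ (v i) (charPoly (toℤ N) q) ⟨
      ∣ v i * charPoly (toℤ N) q ∣        ≡⟨ cramer (charColumns (toℤ N) q) v (λ _ → 1ℚ) 1≡Σvc i (full (suc m)) ⟩
      ∣ minorForm i q ∣                   ≤⟨ proj₂ (proj₂ (bound i)) q 0≤q q≤B ⟩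
      K i                                 ∎
    Pw≤ : ∀ i → P * w i ≤ t * K i
    Pw≤ i = begin
      P * w i                       ≤⟨ *-monoˡ (ℚ.0≤∣p∣ (charPoly (toℤ N) q)) (p≤p+q (0≤tv-w i)) ⟩
      P * (w i + (t * v i - w i))   ≡⟨ solve 4 (λ P w t v → P :* (w :+ (t :* v :- w)) := t :* (v :* P)) refl P (w i) t (v i) ⟩
      t * (v i * P)                 ≤⟨ *-monoˡ 0≤t (vP≤K i) ⟩
      t * K i                       ∎

walks : ∀ {n} → Matrix ℚ n → ℕ → Vector ℚ n
walks A zero    = λ _ → 1ℚ
walks A (suc k) = A · walks A k

-- v = (q - A)⁻¹1 satisfies 1 ≤ q v and A v ≤ q v, whence Aᵏ1 ≤ qᵏ⁺¹ v by induction.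
walks-upper : ∀ {n} {A : Matrix ℚ n} → (∀ i j → 0ℚ ≤ A i j) → ∀ {q} → 0ℚ ≤ q → Subcritical A q →
              ∃ λ C → 0ℚ ≤ C × ∀ k i → walks A k i ≤ C * q ↑ k
walks-upper {A = A} 0≤A {q} 0≤q sub = q * sum v , 0≤* 0≤q (0≤sum 0≤v) , λ k i → begin
  walks A k i           ≤⟨ bounded k i ⟩
  q ↑ suc k * v i       ≤⟨ *-monoˡ (0≤↑ (suc k) 0≤q) (≤sum 0≤v i) ⟩
  q ↑ suc k * sum v     ≡⟨ solve 3 (λ q x s → (q :* x) :* s := (q :* s) :* x) refl q (q ↑ k) (sum v) ⟩
  q * sum v * q ↑ k     ∎
  where
  open ℚ.≤-Reasoning
  solution = resolvent sub (λ _ → 1ℚ) (λ _ → 0≤1)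
  v = proj₁ solution
  0≤v = proj₁ (proj₂ solution)
  qv≡Av+1 = proj₂ (proj₂ solution)
  bounded : ∀ k i → walks A k i ≤ q ↑ suc k * v i
  bounded zero    i = begin
    1ℚ                 ≤⟨ p≤q+p (0≤· 0≤A 0≤v i) ⟩
    (A · v) i + 1ℚ     ≡⟨ qv≡Av+1 i ⟨
    q * v i            ≡⟨ cong (_* v i) (ℚ.*-identityʳ q) ⟨
    q * 1ℚ * v i       ∎
  bounded (suc k) i = begin
    (A · walks A k) i                 ≤⟨ ·-mono 0≤A (bounded k) i ⟩
    (A · λ j → q ↑ suc k * v j) i     ≡⟨ ·-scale A (q ↑ suc k) v i ⟩
    q ↑ suc k * (A · v) i             ≤⟨ *-monoˡ (0≤↑ (suc k) 0≤q) (p≤p+q 0≤1) ⟩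
    q ↑ suc k * ((A · v) i + 1ℚ)      ≡⟨ cong (q ↑ suc k *_) (qv≡Av+1 i) ⟨
    q ↑ suc k * (q * v i)             ≡⟨ solve 3 (λ x q v → x :* (q :* v) := (q :* x) :* v) refl (q ↑ suc k) q (v i) ⟩
    q ↑ suc (suc k) * v i             ∎

-- Since w ≤ W in every entry, qᵏ w ≤ Aᵏ w ≤ W Aᵏ1; summing over the entries and cancelling W leaves
-- no constant.
walks-lower : ∀ {n} {A : Matrix ℚ n} → (∀ i j → 0ℚ ≤ A i j) → ∀ {q} → 0ℚ ≤ q → Supercritical A q →
              ∀ k → q ↑ k ≤ sum (walks A k)
walks-lower {A = A} 0≤A {q} 0≤q (w , 0≤w , 0<W , qw≤Aw) k = *-cancelˡ-≤ 0<W (begin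
  W * q ↑ k                      ≡⟨ ℚ.*-comm W (q ↑ k) ⟩
  q ↑ k * W                      ≡⟨ *-distribˡ-sum (q ↑ k) w ⟩
  sum (λ i → q ↑ k * w i)        ≤⟨ sum-mono (bounded k) ⟩
  sum (λ i → W * walks A k i)    ≡⟨ *-distribˡ-sum W (walks A k) ⟨
  W * sum (walks A k)            ∎)
  where
  open ℚ.≤-Reasoning
  W = sum w
  bounded : ∀ k i → q ↑ k * w i ≤ W * walks A k i
  bounded zero    i = begin
    1ℚ * w i   ≡⟨ ℚ.*-identityˡ (w i) ⟩
    w i        ≤⟨ ≤sum 0≤w i ⟩
    W          ≡⟨ ℚ.*-identityʳ W ⟨
    W * 1ℚ     ∎
  bounded (suc k) i = begin
    (q * q ↑ k) * w i              ≡⟨ solve 3 (λ q x w → (q :* x) :* w := x :* (q :* w)) refl q (q ↑ k) (w i) ⟩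
    q ↑ k * (q * w i)              ≤⟨ *-monoˡ (0≤↑ k 0≤q) (qw≤Aw i) ⟩
    q ↑ k * (A · w) i              ≡⟨ ·-scale A (q ↑ k) w i ⟨
    (A · λ j → q ↑ k * w j) i      ≤⟨ ·-mono 0≤A (bounded k) i ⟩
    (A · λ j → W * walks A k j) i  ≡⟨ ·-scale A W (walks A k) i ⟩
    W * walks A (suc k) i          ∎

-- Real numbers from located cuts

-- `Lo q` stands for q ≤ L and `Up q` for L < q. Every nonnegative rational is put on a side
-- outright, which is stronger than the usual locatedness; the cuts used here allow it because
-- rational arithmetic decides them.
record Cut : Set₁ where
  field
    Lo Up      : ℚ → Set
    located    : ∀ {q} → 0ℚ ≤ q → Lo q ⊎ Up q
    separated  : ∀ {p q} → Lo p → Up q → p < q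
    zeroLo     : Lo 0ℚ
    bound      : ℕ
    boundUp    : Up (ι (+ bound))

grid : ℕ → ℕ → ℚ
grid k j = ι (+ j) * mesh k

grid-suc : ∀ k j → grid k (suc j) ≡ grid k j + mesh k
grid-suc k j = trans (cong (_* mesh k) (ι-suc j))
  (solve 2 (λ i m → (con 1ℚ :+ i) :* m := i :* m :+ m) refl (ι (+ j)) (mesh k))

0≤grid : ∀ k j → 0ℚ ≤ grid k j
0≤grid k j = 0≤* (0≤ι j) (ℚ.<⇒≤ (0<mesh k))

module Bracket (C : Cut) where
  open Cut C

  -- A search down the grid from `bound`. It stops before index 0, since 0 lies in `Lo` and cannot
  -- also lie in `Up`.
  bracket : ∀ k → ∃ λ j → Lo (grid k j) × Up (grid k j + mesh k)
  bracket k = search (bound ℕ.* suc k) (subst Up (sym top) boundUp)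
    where
    top : grid k (bound ℕ.* suc k) ≡ ι (+ bound)
    top = trans (cong (λ z → ι z * mesh k) (ℤ.pos-* bound (suc k)))
      (trans (cong (_* mesh k) (ι-* (+ bound) (+ suc k)))
        (trans (ℚ.*-assoc (ι (+ bound)) (ι (+ suc k)) (mesh k))
          (trans (cong (ι (+ bound) *_) (ι*mesh k)) (ℚ.*-identityʳ (ι (+ bound))))))
    search : ∀ j → Up (grid k j) → ∃ λ j → Lo (grid k j) × Up (grid k j + mesh k)
    search zero    up = contradiction
      (separated zeroLo (subst Up (trans (cong (_* mesh k) ι-0) (ℚ.*-zeroˡ (mesh k))) up)) (ℚ.<-irrefl refl)
    search (suc j) up with located (0≤grid k j)
    ... | inj₁ lo  = j , lo , subst Up (grid-suc k j) up
    ... | inj₂ up′ = search j up′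

  lower upper : ℕ → ℚ
  lower k = grid k (proj₁ (bracket k))
  upper k = lower k + mesh k

  lowerLo : ∀ k → Lo (lower k)
  lowerLo k = proj₁ (proj₂ (bracket k))

  upperUp : ∀ k → Up (upper k)
  upperUp k = proj₂ (proj₂ (bracket k))

  0≤lower : ∀ k → 0ℚ ≤ lower k
  0≤lower k = 0≤grid k (proj₁ (bracket k))

  0<upper : ∀ k → 0ℚ < upper k
  0<upper k = ℚ.<-≤-trans (0<mesh k) (p≤q+p (0≤lower k))

  upper-bounded : ∀ k → upper k ≤ ι (+ bound) + 1ℚ
  upper-bounded k = ℚ.+-mono-≤ (ℚ.<⇒≤ (separated (lowerLo k) boundUp))
    (subst (mesh k ≤_) mesh-0 (mesh-anti {0} {k} ℕ.z≤n))

  upper<upper+mesh : ∀ m n → upper m < upper n + mesh m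
  upper<upper+mesh m n = ℚ.+-monoˡ-< (mesh m) (separated (lowerLo m) (upperUp n))

  -- The upper ends are taken as approximations because they are positive and lie in `Up`, so they
  -- are the points at which the resolvent, and hence the bound on the characteristic polynomial, is
  -- available.
  real : ℝ
  real .seq = upper
  real .cauchy ε 0<ε = k , λ m n k≤m k≤n → ∣p∣<ε (diff m n k≤m)
    (subst (_< ε) (sym (neg-sub (upper m) (upper n))) (diff n m k≤n))
    where
    k = proj₁ (archimedean 0<ε)
    diff : ∀ m n → k ≤ℕ m → upper m - upper n < ε
    diff m n k≤m = ℚ.<-trans
      (subst (upper m - upper n <_) (p+q-p (upper n) (mesh m))
        (ℚ.+-monoˡ-< (- upper n) (upper<upper+mesh m n)))
      (ℚ.≤-<-trans (mesh-anti k≤m) (proj₂ (archimedean 0<ε)))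

rootCut : ℕ → ℕ → Cut
rootCut n a = record
  { Lo        = λ q → q ↑ suc n ≤ ι (+ a)
  ; Up        = λ q → 0ℚ ≤ q × ι (+ a) < q ↑ suc n
  ; located   = λ {q} 0≤q → decide q 0≤q
  ; separated = λ lo (0≤q , up) → ↑-cancel-< (suc n) 0≤q (ℚ.≤-<-trans lo up)
  ; zeroLo    = ℚ.≤-trans (ℚ.≤-reflexive (ℚ.*-zeroˡ (0ℚ ↑ n))) (0≤ι a)
  -- a < a + 1 ≤ (a + 1)ⁿ⁺¹.
  ; bound     = suc a
  ; boundUp   = 0≤ι (suc a) , ℚ.<-≤-trans (ι-mono-< {+ a} {+ suc a} (ℤ.+<+ ℕ.≤-refl))
      (ℚ.≤-trans (ℚ.≤-reflexive (sym (ℚ.*-identityʳ (ι (+ suc a)))))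
        (*-monoˡ (0≤ι (suc a)) (1≤↑ n (1≤ι a))))
  }
  where
  decide : ∀ q → 0ℚ ≤ q → q ↑ suc n ≤ ι (+ a) ⊎ (0ℚ ≤ q × ι (+ a) < q ↑ suc n)
  decide q 0≤q = [ inj₁ , (λ up → inj₂ (0≤q , up)) ]′ (≤⊎> (q ↑ suc n) (ι (+ a)))

seq-^ᴿ : ∀ x n k → seq (x ^ᴿ n) k ≡ seq x k ↑ n
seq-^ᴿ x zero    k = refl
seq-^ᴿ x (suc n) k = cong (seq x k *_) (seq-^ᴿ x n k)

root : ℕ → ℕ → ℝ
root n a = Bracket.real (rootCut n a)

-- At stage k, a lies between the powers of `lower k` and `upper k`, which the Lipschitz estimate on
-- [0, B] places within K `mesh k` of each other.
root-isRoot : ∀ n a → IsRoot (suc n) (fromℕ a) (root n a)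
root-isRoot n a = 0≤ρ , ρⁿ≈a
  where
  open Bracket (rootCut n a)
  B = ι (+ suc a) + 1ℚ
  0≤B : 0ℚ ≤ B
  0≤B = 0≤+ (0≤ι (suc a)) 0≤1
  0≤ρ : fromℕ 0 ≤ᴿ root n a
  0≤ρ ε 0<ε = 0 , λ k _ → ℚ.<-≤-trans 0<ε (p≤q+p (ℚ.<⇒≤ (0<upper k)))
  ρⁿ≈a : root n a ^ᴿ suc n ≈ᴿ fromℕ a
  ρⁿ≈a ε 0<ε = proj₁ small , λ k k₀≤k →
    subst₂ (λ y z → ∣ y - z ∣ < ε) (sym (seq-^ᴿ (root n a) (suc n) k)) (ι≡/1 (+ a))
      (∣p∣<ε
        (begin-strict
          upper k ↑ suc n - ι (+ a)            ≤⟨ ℚ.+-monoʳ-≤ (upper k ↑ suc n) (ℚ.neg-antimono-≤ (lowerLo k)) ⟩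
          upper k ↑ suc n - lower k ↑ suc n    ≤⟨ lip (0≤lower k) (p≤p+q (ℚ.<⇒≤ (0<mesh k))) (upper-bounded k) ⟩
          K * (lower k + mesh k - lower k)     ≡⟨ cong (K *_) (p+q-p (lower k) (mesh k)) ⟩
          K * mesh k                           <⟨ proj₂ small k k₀≤k ⟩
          ε                                    ∎)
        (begin-strict
          - (upper k ↑ suc n - ι (+ a))        ≡⟨ neg-sub (upper k ↑ suc n) (ι (+ a)) ⟩
          ι (+ a) - upper k ↑ suc n            <⟨ ℚ.+-monoˡ-< (- (upper k ↑ suc n)) (proj₂ (upperUp k)) ⟩
          upper k ↑ suc n - upper k ↑ suc n    ≡⟨ ℚ.+-inverseʳ (upper k ↑ suc n) ⟩
          0ℚ                                   <⟨ 0<ε ⟩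
          ε                                    ∎))
    where
    open ℚ.≤-Reasoning
    lipschitz = ↑-lipschitz (suc n) 0≤B
    K = proj₁ lipschitz
    lip : ∀ {p q} → 0ℚ ≤ p → p ≤ q → q ≤ B → q ↑ suc n - p ↑ suc n ≤ K * (q - p)
    lip = proj₂ (proj₂ lipschitz)
    small = meshVanishes (proj₁ (proj₂ lipschitz)) 0<ε

-- Exponential growth rates

-- Growth rates need to be known only eventually and up to constant factors: moving a base by d lets
-- `↑-dominates` swallow the constant.
module RootLimit (a : ℕ → ℕ) (C : Cut)
  (growthLo : ∀ {q} → 0ℚ ≤ q → Cut.Lo C q → ∃ λ K → 0ℚ < K × ∃ λ n₀ → ∀ n → n₀ ≤ℕ n → q ↑ n ≤ K * ι (+ a n))
  (growthUp : ∀ {q} → 0ℚ < q → Cut.Up C q → ∃ λ K → 0ℚ ≤ K × ∃ λ n₀ → ∀ n → n₀ ≤ℕ n → ι (+ a n) ≤ K * q ↑ n)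
  where

  open Cut C
  open Bracket C

  roots : ℕ → ℝ
  roots zero    = fromℕ 0
  roots (suc n) = root n (a (suc n))

  module At (κ : ℕ) where
    d l u : ℚ
    d = mesh κ
    l = lower κ
    u = upper κ

    0≤u+d : 0ℚ ≤ u + d
    0≤u+d = 0≤+ (ℚ.<⇒≤ (0<upper κ)) (ℚ.<⇒≤ (0<mesh κ))

    l-d<l : l - d < l
    l-d<l = subst (l - d <_) (ℚ.+-identityʳ l) (ℚ.+-monoʳ-< l (ℚ.neg-antimono-< (0<mesh κ)))

    rootUpper : ∃ λ n₀ → ∀ n → n₀ ≤ℕ suc n → ∀ q → q ↑ suc n ≤ ι (+ a (suc n)) → q ≤ u + d
    rootUpper = n₁ ℕ.⊔ n₂ , λ n n₀≤n q qⁿ≤a → ↑-cancel-≤ n 0≤u+d (begin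
      q ↑ suc n              ≤⟨ qⁿ≤a ⟩
      ι (+ a (suc n))        ≤⟨ proj₂ (proj₂ (proj₂ growth)) (suc n) (ℕ.m⊔n≤o⇒m≤o n₁ n₂ n₀≤n) ⟩
      K * u ↑ suc n          ≤⟨ proj₂ dominates (suc n) (ℕ.m⊔n≤o⇒n≤o n₁ n₂ n₀≤n) ⟩
      (u + d) ↑ suc n        ∎)
      where
      open ℚ.≤-Reasoning
      growth = growthUp (0<upper κ) (upperUp κ)
      K = proj₁ growth
      n₁ = proj₁ (proj₂ (proj₂ growth))
      dominates : ∃ λ n₀ → ∀ n → n₀ ≤ℕ n → K * u ↑ n ≤ (u + d) ↑ n
      dominates = ↑-dominates (0<upper κ) (p<p+q (0<mesh κ)) (proj₁ (proj₂ growth))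
      n₂ = proj₁ dominates

    rootLower : ∃ λ n₀ → ∀ n → n₀ ≤ℕ suc n → ∀ q → 0ℚ < q → ι (+ a (suc n)) < q ↑ suc n → l - d < q
    -- `↑-dominates` asks for a positive base; if l - d is not positive, it lies below every q > 0
    -- anyway.
    rootLower = [ nonpositive , positive′ ]′ (≤⊎> (l - d) 0ℚ)
      where
      Claim : Set
      Claim = ∃ λ n₀ → ∀ n → n₀ ≤ℕ suc n → ∀ q → 0ℚ < q → ι (+ a (suc n)) < q ↑ suc n → l - d < q
      nonpositive : l - d ≤ 0ℚ → Claim
      nonpositive l-d≤0 = 0 , λ n _ q 0<q _ → ℚ.≤-<-trans l-d≤0 0<q
      positive′ : 0ℚ < l - d → Claim
      positive′ 0<l-d = n₁ ℕ.⊔ n₂ , λ n n₀≤n q 0<q a<qⁿ → ↑-cancel-< (suc n) (ℚ.<⇒≤ 0<q)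
        (ℚ.≤-<-trans
          (*-cancelˡ-≤ {K} {(l - d) ↑ suc n} {ι (+ a (suc n))} (proj₁ (proj₂ growth)) (ℚ.≤-trans
            (proj₂ dominates (suc n) (ℕ.m⊔n≤o⇒n≤o n₁ n₂ n₀≤n))
            (proj₂ (proj₂ (proj₂ growth)) (suc n) (ℕ.m⊔n≤o⇒m≤o n₁ n₂ n₀≤n))))
          a<qⁿ)
        where
        growth = growthLo (0≤lower κ) (lowerLo κ)
        K = proj₁ growth
        n₁ = proj₁ (proj₂ (proj₂ growth))
        dominates : ∃ λ n₀ → ∀ n → n₀ ≤ℕ n → K * (l - d) ↑ n ≤ l ↑ n
        dominates = ↑-dominates 0<l-d l-d<l (ℚ.<⇒≤ (proj₁ (proj₂ growth)))
        n₂ = proj₁ dominates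

    -- x′ and y′ are lower grid approximations, of mesh m, of a root and of the limit.
    squeeze : ∀ {m x′ y′ ε} → x′ ≤ u + d → l - d < x′ + m → l < y′ + m → y′ < u → (1ℚ + 1ℚ) * d + m < ε →
              ∣ (x′ + m) - (y′ + m) ∣ < ε
    squeeze {m} {x′} {y′} {ε} x′≤u+d l-d<x l<y y′<u small = ∣p∣<ε
      (begin-strict
        (x′ + m) - (y′ + m)      <⟨ ℚ.+-mono-≤-< (ℚ.+-monoˡ-≤ m x′≤u+d) (ℚ.neg-antimono-< l<y) ⟩
        (u + d + m) - l          ≡⟨ eq₁ l d m ⟩
        (1ℚ + 1ℚ) * d + m        <⟨ small ⟩
        ε                        ∎)
      (begin-strict
        - ((x′ + m) - (y′ + m))  ≡⟨ neg-sub (x′ + m) (y′ + m) ⟩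
        (y′ + m) - (x′ + m)      <⟨ ℚ.+-mono-< (ℚ.+-monoˡ-< m y′<u) (ℚ.neg-antimono-< l-d<x) ⟩
        (u + m) - (l - d)        ≡⟨ eq₂ l d m ⟩
        (1ℚ + 1ℚ) * d + m        <⟨ small ⟩
        ε                        ∎)
      where
      open ℚ.≤-Reasoning
      eq₁ : ∀ l d m → (l + d + d + m) - l ≡ (1ℚ + 1ℚ) * d + m
      eq₁ = solve 3 (λ l d m → (l :+ d :+ d :+ m) :- l := (con 1ℚ :+ con 1ℚ) :* d :+ m) refl
      eq₂ : ∀ l d m → (l + d + m) - (l - d) ≡ (1ℚ + 1ℚ) * d + m
      eq₂ = solve 3 (λ l d m → (l :+ d :+ m) :- (l :- d) := (con 1ℚ :+ con 1ℚ) :* d :+ m) refl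

  -- Roots lie within [l - d, u + d] and the limit within [l, u], where u = l + d. The coarse mesh
  -- is chosen with 2d < ε, and the approximation mesh m is paid for by the slack ε′ in `_≤ᴿ_`.
  roots-converge : roots ⟶ real
  roots-converge ε 0<ε = suc (n₁ ℕ.⊔ n₂) , close
    where
    vanishes = meshVanishes {1ℚ + 1ℚ} (0≤+ 0≤1 0≤1) 0<ε
    κ = proj₁ vanishes
    open At κ
    n₁ = proj₁ rootUpper
    n₂ = proj₁ rootLower
    close : ∀ n → suc (n₁ ℕ.⊔ n₂) ≤ℕ n → ∣ roots n -ᴿ real ∣ᴿ ≤ᴿ fromℚ ε
    close (suc n) (ℕ.s≤s n₀≤n) ε′ 0<ε′ = proj₁ (archimedean 0<ε′) , λ k k₀≤k → squeeze
      (proj₂ rootUpper n (ℕ.m≤n⇒m≤1+n (ℕ.m⊔n≤o⇒m≤o n₁ n₂ n₀≤n)) (R.lower k) (R.lowerLo k))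
      (proj₂ rootLower n (ℕ.m≤n⇒m≤1+n (ℕ.m⊔n≤o⇒n≤o n₁ n₂ n₀≤n)) (R.upper k) (R.0<upper k) (proj₂ (R.upperUp k)))
      (separated (lowerLo κ) (upperUp k))
      (separated (lowerLo k) (upperUp κ))
      (ℚ.+-mono-< (proj₂ vanishes κ ℕ.≤-refl) (ℚ.≤-<-trans (mesh-anti k₀≤k) (proj₂ (archimedean 0<ε′))))
      where module R = Bracket (rootCut n (a (suc n)))

  roots-areRoots : ∀ n → 1 ≤ℕ n → IsRoot n (fromℕ (a n)) (roots n)
  roots-areRoots (suc n) _ = root-isRoot n (a (suc n))

-- The spectral radius and the growth of walks

-- With at least one coordinate the all-ones vector is nonzero and certifies that 0 belongs to `Lo`;
-- the empty matrix is served by `zeroCut`.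
spectralCut : ∀ {m} → Matrix ℕ (suc m) → Cut
spectralCut {m} N = record
  { Lo        = Supercritical A
  ; Up        = Subcritical A
  ; located   = λ {q} _ → dichotomy A (0≤toℚ N) q
  ; separated = super<sub A (0≤toℚ N)
  ; zeroLo    = (λ _ → 1ℚ) , (λ _ → 0≤1) , ℚ.<-≤-trans 0<1 (≤sum {f = λ (_ : Fin (suc m)) → 1ℚ} (λ _ → 0≤1) zero) , λ i →
      ℚ.≤-trans (ℚ.≤-reflexive (ℚ.*-zeroˡ 1ℚ)) (0≤· (0≤toℚ N) (λ _ → 0≤1) i)
  ; bound     = suc (proj₁ large)
  ; boundUp   = [ (λ super → contradiction (super≤M _ super) M<bound) , id ]′
      (dichotomy A (0≤toℚ N) (ι (+ suc (proj₁ large))))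
  }
  where
  A = toℚ N
  -- The sum of all entries of A bounds every supercritical q ≥ 0, by `walks-lower` with exponent 1,
  -- so any integer above it is subcritical.
  M = sum (walks A 1)
  large : ∃ λ n₀ → ∀ n → n₀ ≤ℕ n → M ≤ ι (+ n) * 1ℚ
  large = multiplesUnbounded (0≤sum (0≤· (0≤toℚ N) (λ _ → 0≤1))) 0<1
  super≤M : ∀ n → Supercritical A (ι (+ n)) → ι (+ n) ≤ M
  super≤M n super = subst (_≤ M) (ℚ.*-identityʳ (ι (+ n))) (walks-lower (0≤toℚ N) (0≤ι n) super 1)
  M<bound : ¬ (ι (+ suc (proj₁ large)) ≤ M)
  M<bound ≤M = ℚ.<-irrefl refl (ℚ.<-≤-trans
    (ι-mono-< {+ proj₁ large} {+ suc (proj₁ large)} (ℤ.+<+ ℕ.≤-refl))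
    (ℚ.≤-trans ≤M (subst (M ≤_) (ℚ.*-identityʳ _) (proj₂ large (proj₁ large) ℕ.≤-refl))))

seq-evalMonic : ∀ {d} (c : Vec ℤ d) x k → seq (evalMonic c x) k ≡ evalMonicℚ c (seq x k)
seq-evalMonic []       x k = refl
seq-evalMonic (c ∷ cs) x k = cong₂ _+_ (sym (ι≡/1 c)) (cong (seq x k *_) (seq-evalMonic cs x k))

spectralRadius-root : ∀ {m} (N : Matrix ℕ (suc m)) →
  evalMonic (proj₁ (charPoly-monic (toℤ N))) (Bracket.real (spectralCut N)) ≈ᴿ fromℕ 0
spectralRadius-root N ε 0<ε = proj₁ small , λ k k₀≤k → subst (_< ε) (sym (value k))
  (ℚ.≤-<-trans (near k) (proj₂ small k k₀≤k))
  where
  open Bracket (spectralCut N)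
  P = charPoly (toℤ N)
  c = proj₁ (charPoly-monic (toℤ N))
  B = ι (+ Cut.bound (spectralCut N)) + 1ℚ
  tiny = charPoly-small N B (0≤+ (0≤ι (Cut.bound (spectralCut N))) 0≤1)
  K = proj₁ tiny
  small = meshVanishes {K} (proj₁ (proj₂ tiny)) 0<ε
  near : ∀ k → ∣ P (upper k) ∣ ≤ K * mesh k
  near k = subst (λ z → ∣ P (upper k) ∣ ≤ K * z) (p+q-p (lower k) (mesh k))
    (proj₂ (proj₂ tiny) (ℚ.<⇒≤ (0<upper k)) (upper-bounded k) (lowerLo k) (upperUp k))
  value : ∀ k → ∣ seq (evalMonic c real) k - 0ℚ ∣ ≡ ∣ P (upper k) ∣
  value k = cong ∣_∣ (trans (ℚ.+-identityʳ _)
    (trans (seq-evalMonic c real k) (sym (proj₂ (charPoly-monic (toℤ N)) (upper k)))))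

ι-sum : ∀ {n} (f : Fin n → ℕ) → ι (+ sumℕ f) ≡ sum λ i → ι (+ f i)
ι-sum {zero}  f = ι-0
ι-sum {suc n} f = trans (ι-+ (+ f zero) (+ sumℕ (tail f))) (cong (λ z → ι (+ f zero) + z) (ι-sum (tail f)))

-- The real number 0, the growth rate of a sequence that is eventually zero.
zeroCut : Cut
zeroCut = record
  { Lo        = λ q → q ≡ 0ℚ
  ; Up        = λ q → 0ℚ < q
  ; located   = λ {q} 0≤q → [ (λ q≤0 → inj₁ (ℚ.≤-antisym q≤0 0≤q)) , inj₂ ]′ (≤⊎> q 0ℚ)
  ; separated = λ { refl 0<q → 0<q }
  ; zeroLo    = refl
  ; bound     = 1
  ; boundUp   = ℚ.<-≤-trans 0<1 (1≤ι 0)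
  }

zeroCut-root : evalMonic (+ 0 ∷ []) (Bracket.real zeroCut) ≈ᴿ fromℕ 0
zeroCut-root ε 0<ε = proj₁ (archimedean 0<ε) , λ k k₀≤k → subst (_< ε) (sym (value k))
  (ℚ.≤-<-trans (mesh-anti k₀≤k) (proj₂ (archimedean 0<ε)))
  where
  open Bracket zeroCut
  value : ∀ k → ∣ (+ 0 / 1 + upper k * 1ℚ) - 0ℚ ∣ ≡ mesh k
  value k = trans
    (cong (λ z → ∣ (0ℚ + (z + mesh k) * 1ℚ) - 0ℚ ∣) (lowerLo k))
    (trans (cong ∣_∣ (solve 1 (λ m → con 0ℚ :+ (con 0ℚ :+ m) :* con 1ℚ :- con 0ℚ := m) refl (mesh k)))
      (ℚ.0≤p⇒∣p∣≡p (ℚ.<⇒≤ (0<mesh k))))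

HasRootLimit : (ℕ → ℕ) → ℝ → Set
HasRootLimit a L = ∃ λ (ρ : ℕ → ℝ) → (∀ n → 1 ≤ℕ n → IsRoot n (fromℕ (a n)) (ρ n)) × ρ ⟶ L

module _ (a : ℕ → ℕ) (s c : ℕ) where

  eventually : ∀ {P : ℕ → Set} → (∀ k → P (k ℕ.+ s)) → ∀ n → s ≤ℕ n → P n
  eventually {P} p n s≤n = subst P (ℕ.m∸n+n≡m s≤n) (p (n ∸ s))

  -- In dimension 0 the sequence vanishes from s on and the limit 0 is a root of x, whose degree
  -- exceeds n; the guard `a s ≢ 0` excludes just this case. The factor `suc c` is positive, which
  -- the lower growth bound uses.
  walkGrowth : ∀ n (N : Matrix ℕ n) (f : ℕ → Fin n → ℕ) →
    (∀ i → f 0 i ≡ 1) → (∀ k i → f (suc k) i ≡ sumℕ λ j → N i j ℕ.* f k j) →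
    (∀ k → a (k ℕ.+ s) ≡ suc c ℕ.* sumℕ (f k)) →
    Σ ℝ λ L → HasRootLimit a L × Σ ℕ λ d → Σ (Vec ℤ d) λ p →
      evalMonic p L ≈ᴿ fromℕ 0 × (a s ≢ 0 → d ≤ℕ n)
  walkGrowth zero N f f₀ f₊ a≡ =
    Bracket.real zeroCut , (Limit.roots , Limit.roots-areRoots , Limit.roots-converge) ,
    1 , (+ 0 ∷ []) , zeroCut-root , λ aₛ≢0 → contradiction (a≡0 0) aₛ≢0
    where
    a≡0 : ∀ k → a (k ℕ.+ s) ≡ 0
    a≡0 k = trans (a≡ k) (ℕ.*-zeroʳ (suc c))
    growthLo : ∀ {q} → 0ℚ ≤ q → q ≡ 0ℚ →
      ∃ λ K → 0ℚ < K × ∃ λ n₀ → ∀ n → n₀ ≤ℕ n → q ↑ n ≤ K * ι (+ a n)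
    -- The bound starts at n = 1 because 0⁰ = 1, whereas `a 0` may be zero.
    growthLo _ refl = 1ℚ , 0<1 , 1 , λ { (suc n) _ →
      ℚ.≤-trans (ℚ.≤-reflexive (ℚ.*-zeroˡ (0ℚ ↑ n))) (0≤* 0≤1 (0≤ι (a (suc n)))) }
    growthUp : ∀ {q} → 0ℚ < q → 0ℚ < q →
      ∃ λ K → 0ℚ ≤ K × ∃ λ n₀ → ∀ n → n₀ ≤ℕ n → ι (+ a n) ≤ K * q ↑ n
    growthUp {q} 0<q _ = 1ℚ , 0≤1 , s , eventually {λ n → ι (+ a n) ≤ 1ℚ * q ↑ n} λ k →
      ℚ.≤-trans (ℚ.≤-reflexive (trans (cong (λ z → ι (+ z)) (a≡0 k)) ι-0))
        (0≤* 0≤1 (0≤↑ (k ℕ.+ s) (ℚ.<⇒≤ 0<q)))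
    module Limit = RootLimit a zeroCut growthLo growthUp
  walkGrowth n@(suc m) N f f₀ f₊ a≡ =
    Bracket.real (spectralCut N) , (Limit.roots , Limit.roots-areRoots , Limit.roots-converge) ,
    n , proj₁ (charPoly-monic (toℤ N)) , spectralRadius-root N , λ _ → ℕ.≤-refl
    where
    open ℚ.≤-Reasoning
    A = toℚ N
    C = ι (+ suc c)
    ιf : ∀ k i → ι (+ f k i) ≡ walks A k i
    ιf zero    i = trans (cong (λ z → ι (+ z)) (f₀ i)) ι-1
    ιf (suc k) i = trans (cong (λ z → ι (+ z)) (f₊ k i))
      (trans (ι-sum (λ j → N i j ℕ.* f k j))
        (sum-cong-≗ λ j → trans (cong ι (ℤ.pos-* (N i j) (f k j)))
          (trans (ι-* (+ N i j) (+ f k j)) (cong (A i j *_) (ιf k j)))))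
    ιa : ∀ k → ι (+ a (k ℕ.+ s)) ≡ C * sum (walks A k)
    ιa k = trans (cong (λ z → ι (+ z)) (a≡ k))
      (trans (cong ι (ℤ.pos-* (suc c) (sumℕ (f k))))
        (trans (ι-* (+ suc c) (+ sumℕ (f k)))
          (cong (C *_) (trans (ι-sum (f k)) (sum-cong-≗ (ιf k))))))
    0≤walks : ∀ k i → 0ℚ ≤ walks A k i
    0≤walks k i = subst (0ℚ ≤_) (ιf k i) (0≤ι (f k i))
    growthLo : ∀ {q} → 0ℚ ≤ q → Supercritical A q →
      ∃ λ K → 0ℚ < K × ∃ λ n₀ → ∀ n → n₀ ≤ℕ n → q ↑ n ≤ K * ι (+ a n)
    -- The factor qˢ makes up for the index shift; the added 1 keeps the constant positive when q =
    -- 0.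
    growthLo {q} 0≤q super = q ↑ s + 1ℚ , ℚ.<-≤-trans 0<1 (p≤q+p (0≤↑ s 0≤q)) , s ,
      eventually {λ n → q ↑ n ≤ (q ↑ s + 1ℚ) * ι (+ a n)} λ k → begin
        q ↑ (k ℕ.+ s)                             ≡⟨ ^-homo-* q k s ⟩
        q ↑ k * q ↑ s                             ≡⟨ ℚ.*-comm (q ↑ k) (q ↑ s) ⟩
        q ↑ s * q ↑ k                             ≤⟨ *-mono-≤ (0≤↑ s 0≤q) (0≤sum (0≤walks k)) (p≤p+q {q ↑ s} 0≤1)
                                                       (walks-lower (0≤toℚ N) 0≤q super k) ⟩
        (q ↑ s + 1ℚ) * sum (walks A k)            ≡⟨ cong ((q ↑ s + 1ℚ) *_) (ℚ.*-identityˡ (sum (walks A k))) ⟨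
        (q ↑ s + 1ℚ) * (1ℚ * sum (walks A k))     ≤⟨ *-monoˡ (0≤+ (0≤↑ s 0≤q) 0≤1) (*-monoʳ (0≤sum (0≤walks k)) (1≤ι c)) ⟩
        (q ↑ s + 1ℚ) * (C * sum (walks A k))      ≡⟨ cong ((q ↑ s + 1ℚ) *_) (ιa k) ⟨
        (q ↑ s + 1ℚ) * ι (+ a (k ℕ.+ s))          ∎
    growthUp : ∀ {q} → 0ℚ < q → Subcritical A q →
      ∃ λ K → 0ℚ ≤ K × ∃ λ n₀ → ∀ n → n₀ ≤ℕ n → ι (+ a n) ≤ K * q ↑ n
    -- r = q⁻ˢ makes up for the index shift, and `sum E` is D added once for each coordinate.
    growthUp {q} 0<q sub = C * sum E * r , 0≤* (0≤* (0≤ι (suc c)) (0≤sum {f = E} λ _ → 0≤D)) (ℚ.<⇒≤ 0<r) , s ,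
      eventually {λ n → ι (+ a n) ≤ C * sum E * r * q ↑ n} λ k → begin
        ι (+ a (k ℕ.+ s))                         ≡⟨ ιa k ⟩
        C * sum (walks A k)                       ≤⟨ *-monoˡ (0≤ι (suc c)) (sum-mono (walks≤ k)) ⟩
        C * sum (λ i → E i * q ↑ k)               ≡⟨ cong (C *_) (*-distribʳ-sum (q ↑ k) E) ⟨
        C * (sum E * q ↑ k)                       ≡⟨ assemble C (sum E) (q ↑ k) (q ↑ s) r qˢr≡1 ⟨
        C * sum E * r * (q ↑ k * q ↑ s)           ≡⟨ cong (C * sum E * r *_) (^-homo-* q k s) ⟨
        C * sum E * r * q ↑ (k ℕ.+ s)             ∎
      where
      upper = walks-upper (0≤toℚ N) (ℚ.<⇒≤ 0<q) sub
      D = proj₁ upper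
      0≤D = proj₁ (proj₂ upper)
      E : Vector ℚ n
      E _ = D
      walks≤ : ∀ k i → walks A k i ≤ E i * q ↑ k
      walks≤ = proj₂ (proj₂ upper)
      inv = inverse (0<↑ s 0<q)
      r = proj₁ inv
      0<r = proj₁ (proj₂ inv)
      qˢr≡1 = proj₂ (proj₂ inv)
      assemble : ∀ c e x y r → y * r ≡ 1ℚ → c * e * r * (x * y) ≡ c * (e * x)
      assemble c e x y r yr≡1 = trans
        (solve 5 (λ c e x y r → c :* e :* r :* (x :* y) := c :* (e :* x) :* (y :* r)) refl c e x y r)
        (trans (cong (c * (e * x) *_) yr≡1) (ℚ.*-identityʳ (c * (e * x))))
    module Limit = RootLimit a (spectralCut N) growthLo growthUp

-- Weighted sums over melodies

-- The Iverson bracket, which makes counting a sum that can be factored and reindexed.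
⟦_⟧ : ∀ {P : Set} → Dec P → ℕ
⟦ p? ⟧ = if does p? then 1 else 0

⟦⟧-cong : ∀ {P Q : Set} (p? : Dec P) (q? : Dec Q) → (P → Q) → (Q → P) → ⟦ p? ⟧ ≡ ⟦ q? ⟧
⟦⟧-cong (yes p) (yes q) _   _   = refl
⟦⟧-cong (yes p) (no ¬q) p→q _   = contradiction (p→q p) ¬q
⟦⟧-cong (no ¬p) (yes q) _   q→p = contradiction (q→p q) ¬p
⟦⟧-cong (no ¬p) (no ¬q) _   _   = refl

⟦⟧-× : ∀ {P Q R : Set} (p? : Dec P) (q? : Dec Q) (r? : Dec R) →
       (P → Q) → (P → R) → (Q → R → P) → ⟦ p? ⟧ ≡ ⟦ q? ⟧ ℕ.* ⟦ r? ⟧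
⟦⟧-× (yes p) (yes q) (yes r) _   _   _    = refl
⟦⟧-× (yes p) (yes q) (no ¬r) _   p→r _    = contradiction (p→r p) ¬r
⟦⟧-× (yes p) (no ¬q) _       p→q _   _    = contradiction (p→q p) ¬q
⟦⟧-× (no ¬p) (yes q) (yes r) _   _   qr→p = contradiction (qr→p q r) ¬p
⟦⟧-× (no ¬p) (yes q) (no ¬r) _   _   _    = refl
⟦⟧-× (no ¬p) (no ¬q) _       _   _   _    = refl

-- Taken over positions, so that a sum over `states` is by definition a sum over the indices of the
-- transfer matrix.
sumL : ∀ {X : Set} → (X → ℕ) → List X → ℕ
sumL g xs = sumℕ λ i → g (lookup xs i)

module _ {X : Set} where

  sumL-one : ∀ (xs : List X) → sumL (λ _ → 1) xs ≡ length xs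
  sumL-one []       = refl
  sumL-one (x ∷ xs) = cong suc (sumL-one xs)

  sumL-++ : ∀ (g : X → ℕ) xs ys → sumL g (xs ++ ys) ≡ sumL g xs ℕ.+ sumL g ys
  sumL-++ g []       ys = refl
  sumL-++ g (x ∷ xs) ys = trans (cong (g x ℕ.+_) (sumL-++ g xs ys)) (sym (ℕ.+-assoc (g x) _ _))

  sumL-map : ∀ {Y : Set} (g : X → ℕ) (f : Y → X) ys → sumL g (List.map f ys) ≡ sumL (g ∘ f) ys
  sumL-map g f []       = refl
  sumL-map g f (y ∷ ys) = cong (g (f y) ℕ.+_) (sumL-map g f ys)

  sumL-filter : ∀ {P : X → Set} (P? : ∀ x → Dec (P x)) (g : X → ℕ) xs →
                sumL g (filter P? xs) ≡ sumL (λ x → ⟦ P? x ⟧ ℕ.* g x) xs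
  sumL-filter P? g []       = refl
  sumL-filter P? g (x ∷ xs) with P? x
  ... | yes _ = cong₂ ℕ._+_ (sym (ℕ.*-identityˡ (g x))) (sumL-filter P? g xs)
  ... | no  _ = sumL-filter P? g xs

  sumL-cartesianProductWith : ∀ {Y Z : Set} (g : X → ℕ) (f : Y → Z → X) ys zs →
    sumL g (cartesianProductWith f ys zs) ≡ sumL (λ y → sumL (λ z → g (f y z)) zs) ys
  sumL-cartesianProductWith g f []       zs = refl
  sumL-cartesianProductWith g f (y ∷ ys) zs = trans
    (sumL-++ g (List.map (f y) zs) (cartesianProductWith f ys zs))
    (cong₂ ℕ._+_ (sumL-map g (f y) zs) (sumL-cartesianProductWith g f ys zs))

  sumL-tabulate : ∀ (g : X → ℕ) {n} (f : Fin n → X) → sumL g (List.tabulate f) ≡ sumℕ (g ∘ f)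
  sumL-tabulate g {zero}  f = refl
  sumL-tabulate g {suc n} f = cong (g (f zero) ℕ.+_) (sumL-tabulate g (f ∘ suc))

Σmelodies : ∀ m → (Melody m → ℕ) → ℕ
Σmelodies zero    g = g []
Σmelodies (suc m) g = sumℕ λ a → Σmelodies m λ x → g (a ∷ x)

Σmelodies-cong : ∀ m {g h} → (∀ x → g x ≡ h x) → Σmelodies m g ≡ Σmelodies m h
Σmelodies-cong zero    g≗h = g≗h []
Σmelodies-cong (suc m) g≗h = sumℕ-cong λ a → Σmelodies-cong m λ x → g≗h (a ∷ x)

sumL-melodies : ∀ m g → sumL g (melodies m) ≡ Σmelodies m g
sumL-melodies zero    g = ℕ.+-identityʳ (g [])
sumL-melodies (suc m) g = trans (sumL-cartesianProductWith g _∷_ (allFin 7) (melodies m))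
  (trans (sumL-tabulate (λ a → sumL (λ x → g (a ∷ x)) (melodies m)) id)
    (sumℕ-cong λ a → sumL-melodies m (λ x → g (a ∷ x))))

Σmelodies-sum : ∀ m {n} (g : Fin n → Melody m → ℕ) →
                Σmelodies m (λ x → sumℕ λ a → g a x) ≡ sumℕ λ a → Σmelodies m (g a)
Σmelodies-sum zero    g = refl
Σmelodies-sum (suc m) g = trans
  (sumℕ-cong λ b → Σmelodies-sum m (λ a x → g a (b ∷ x)))
  (sumℕ-comm λ b a → Σmelodies m (λ x → g a (b ∷ x)))

∈-melodies : ∀ {n} (x : Melody n) → x ∈ melodies n
∈-melodies []      = here refl
∈-melodies (a ∷ x) = ∈-cartesianProductWith⁺ _∷_ (∈-allFin a) (∈-melodies x)

Σmelodies-one : ∀ n → Σmelodies n (λ _ → 1) ≡ 7 ^ n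
Σmelodies-one zero    = refl
Σmelodies-one (suc n) = cong (7 ℕ.*_) (Σmelodies-one n)

V-Σmelodies : ∀ {r} (S : CanonicScheme r) n → V n S ≡ Σmelodies n (λ x → ⟦ validCanon? S x ⟧)
V-Σmelodies S n = begin
  V n S                                                            ≡⟨ sumL-one (filter (validCanon? S) (melodies n)) ⟨
  sumL (λ _ → 1) (filter (validCanon? S) (melodies n))             ≡⟨ sumL-filter (validCanon? S) (λ _ → 1) (melodies n) ⟩
  sumL (λ x → ⟦ validCanon? S x ⟧ ℕ.* 1) (melodies n)              ≡⟨ sumL-melodies n _ ⟩
  Σmelodies n (λ x → ⟦ validCanon? S x ⟧ ℕ.* 1)                    ≡⟨ Σmelodies-cong n (λ x → ℕ.*-identityʳ _) ⟩
  Σmelodies n (λ x → ⟦ validCanon? S x ⟧)                          ∎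
  where open ≡-Reasoning

-- Translations

⊞-comm-assoc : ∀ a b c → (a ⊞ b) ⊞ c ≡ (a ⊞ c) ⊞ b
⊞-comm-assoc = from-yes (Fin.all? λ a → Fin.all? λ b → Fin.all? λ c → (a ⊞ b) ⊞ c Fin.≟ (a ⊞ c) ⊞ b)

⊞-⊟-cancel : ∀ a b c → (a ⊞ c) ⊟ (b ⊞ c) ≡ a ⊟ b
⊞-⊟-cancel = from-yes (Fin.all? λ a → Fin.all? λ b → Fin.all? λ c → (a ⊞ c) ⊟ (b ⊞ c) Fin.≟ a ⊟ b)

a⊟b⊞b : ∀ b a → (a ⊟ b) ⊞ b ≡ a
a⊟b⊞b = from-yes (Fin.all? λ b → Fin.all? λ a → (a ⊟ b) ⊞ b Fin.≟ a)

a⊞b⊟b : ∀ b a → (a ⊞ b) ⊟ b ≡ a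
a⊞b⊟b = from-yes (Fin.all? λ b → Fin.all? λ a → (a ⊞ b) ⊟ b Fin.≟ a)

0⊞ : ∀ a → 0F ⊞ a ≡ a
0⊞ = from-yes (Fin.all? λ a → 0F ⊞ a Fin.≟ a)

a⊞[0⊟a] : ∀ a → a ⊞ (0F ⊟ a) ≡ 0F
a⊞[0⊟a] = from-yes (Fin.all? λ a → a ⊞ (0F ⊟ a) Fin.≟ 0F)

translation : 𝔽₇ → Permutation′ 7
translation c = permutation (_⊞ c) (_⊟ c) (a⊟b⊞b c) (a⊞b⊟b c)

translate : ∀ {n} → 𝔽₇ → Melody n → Melody n
translate c = Vec.map (_⊞ c)

sumℕ-translate : ∀ c (g : 𝔽₇ → ℕ) → sumℕ (λ a → g (a ⊞ c)) ≡ sumℕ g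
sumℕ-translate c g = sym (sumℕ-permute g (translation c))

Σmelodies-translate : ∀ c m (g : Melody m → ℕ) → Σmelodies m (λ x → g (translate c x)) ≡ Σmelodies m g
Σmelodies-translate c zero    g = refl
Σmelodies-translate c (suc m) g = trans
  (sumℕ-cong λ a → Σmelodies-translate c m (λ x → g ((a ⊞ c) ∷ x)))
  (sumℕ-translate c λ a → Σmelodies m (λ x → g (a ∷ x)))

module _ {r} (S : CanonicScheme r) where

  -- Compatibility looks only at differences of simultaneous notes, and a common translation cancels
  -- in them.
  translated-difference : ∀ c {n} (x : Melody n) i j k l →
    (Vec.lookup (translate c x) k ⊞ pitch S i) ⊟ (Vec.lookup (translate c x) l ⊞ pitch S j)
    ≡ (Vec.lookup x k ⊞ pitch S i) ⊟ (Vec.lookup x l ⊞ pitch S j)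
  translated-difference c x i j k l = trans
    (cong₂ (λ a b → (a ⊞ pitch S i) ⊟ (b ⊞ pitch S j)) (Vec.lookup-map k (_⊞ c) x) (Vec.lookup-map l (_⊞ c) x))
    (trans
      (cong₂ _⊟_ (⊞-comm-assoc (Vec.lookup x k) c (pitch S i)) (⊞-comm-assoc (Vec.lookup x l) c (pitch S j)))
      (⊞-⊟-cancel (Vec.lookup x k ⊞ pitch S i) (Vec.lookup x l ⊞ pitch S j) c))

  CompatibleDifference : Fin r → 𝔽₇ → Set
  CompatibleDifference j d = (d ≢ 1F × d ≢ 6F) × (bass S ≡ just j → d ≢ 3F)

  valid-translate⁺ : ∀ c {n} (x : Melody n) → ValidCanon S x → ValidCanon S (translate c x)
  valid-translate⁺ c x valid = fin⇒valid S (translate c x) λ i j k l eq →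
    subst (CompatibleDifference j) (sym (translated-difference c x i j k l)) (valid⇒fin S x valid i j k l eq)

  valid-translate⁻ : ∀ c {n} (x : Melody n) → ValidCanon S (translate c x) → ValidCanon S x
  valid-translate⁻ c x valid = fin⇒valid S x λ i j k l eq →
    subst (CompatibleDifference j) (translated-difference c x i j k l)
      (valid⇒fin S (translate c x) valid i j k l eq)

  valid-tail : ∀ a {n} (x : Melody n) → ValidCanon S (a ∷ x) → ValidCanon S x
  valid-tail a x valid = fin⇒valid S x λ i j k l eq →
    valid⇒fin S (a ∷ x) valid i j (suc k) (suc l) (shifted (time S i) (time S j) (toℕ k) (toℕ l) eq)
    where
    shifted : ∀ t u k l → (t ℤ.+ + suc k) ℤ.- u ≡ + suc l → (t ℤ.+ + suc (suc k)) ℤ.- u ≡ + suc (suc l)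
    shifted t u k l eq = trans (regroup t u (+ suc k)) (cong (λ z → + 1 ℤ.+ z) eq)
      where
      regroup : ∀ t u z → (t ℤ.+ (+ 1 ℤ.+ z)) ℤ.- u ≡ + 1 ℤ.+ ((t ℤ.+ z) ℤ.- u)
      regroup = ℤ-solve

-- Windows of a melody

infix 4 _⊑_

data _⊑_ : ∀ {n m} → Melody n → Melody m → Set where
  []  : ∀ {m} {u : Melody m} → [] ⊑ u
  _∷_ : ∀ a {n m} {w : Melody n} {u : Melody m} → w ⊑ u → a ∷ w ⊑ a ∷ u

⊑-refl : ∀ {n} {w : Melody n} → w ⊑ w
⊑-refl {w = []}    = []
⊑-refl {w = a ∷ w} = a ∷ ⊑-refl

-- Puts a note in front and drops the last one: how a window of fixed length moves when a note is
-- prepended.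
shift : ∀ {n} → 𝔽₇ → Melody n → Melody n
shift a []      = []
shift a (b ∷ w) = a ∷ shift b w

shift-⊑ : ∀ a {n m} {w : Melody n} {u : Melody m} → w ⊑ u → shift a w ⊑ a ∷ u
shift-⊑ a []        = []
shift-⊑ a (b ∷ w⊑u) = a ∷ shift-⊑ b w⊑u

shift-translate : ∀ c a {n} (w : Melody n) → shift (a ⊞ c) (translate c w) ≡ translate c (shift a w)
shift-translate c a []      = refl
shift-translate c a (b ∷ w) = cong (a ⊞ c ∷_) (shift-translate c b w)

-- Index k of `u` also occurs in `w`, with the same note. Neither melody need be the longer one, so
-- constraints can be moved in both directions along a prefix.
Position : ∀ {n m} → Melody n → Melody m → Fin m → Set
Position {n} w u k = ∃ λ (k* : Fin n) → toℕ k* ≡ toℕ k × Vec.lookup w k* ≡ Vec.lookup u k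

⊑-restrict : ∀ {n m} {w : Melody n} {u : Melody m} → w ⊑ u → ∀ k → toℕ k ℕ.< n → Position w u k
⊑-restrict (a ∷ w⊑u) zero    _           = zero , refl , refl
⊑-restrict (a ∷ w⊑u) (suc k) (ℕ.s≤s k<n) with ⊑-restrict w⊑u k k<n
... | k* , k*≡k , eq = suc k* , cong suc k*≡k , eq

⊑-embed : ∀ {n m} {w : Melody n} {u : Melody m} → w ⊑ u → ∀ k → Position u w k
⊑-embed (a ∷ w⊑u) zero    = zero , refl , refl
⊑-embed (a ∷ w⊑u) (suc k) with ⊑-embed w⊑u k
... | k* , k*≡k , eq = suc k* , cong suc k*≡k , eq

module _ {r} (S : CanonicScheme r) where

  transfer-compatible : ∀ {n m} {w : Melody n} {u : Melody m} → ValidCanon S w →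
    ∀ i j k l → Position w u k → Position w u l →
    (time S i ℤ.+ + suc (toℕ k)) ℤ.- time S j ≡ + suc (toℕ l) →
    Compatible S j (Vec.lookup u k ⊞ pitch S i) (Vec.lookup u l ⊞ pitch S j)
  transfer-compatible {w = w} valid i j k l (k* , k*≡k , eqₖ) (l* , l*≡l , eqₗ) eq =
    subst₂ (λ x y → Compatible S j (x ⊞ pitch S i) (y ⊞ pitch S j)) eqₖ eqₗ
      (valid⇒fin S w valid i j k* l*
        (subst₂ (λ k l → (time S i ℤ.+ + suc k) ℤ.- time S j ≡ + suc l) (sym k*≡k) (sym l*≡l) eq))

  valid-⊑ : ∀ {n m} {w : Melody n} {u : Melody m} → w ⊑ u → ValidCanon S u → ValidCanon S w
  valid-⊑ {w = w} {u} w⊑u valid = fin⇒valid S w λ i j k l →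
    transfer-compatible {w = u} {w} valid i j k l (⊑-embed w⊑u k) (⊑-embed w⊑u l)

  -- Notes more than s apart are never sung together.
  valid-∷ : ∀ {s} → (∀ i j → time S i ℤ.- time S j ℤ.≤ + s) →
            ∀ a {m} {w : Melody s} {u : Melody m} → w ⊑ u →
            ValidCanon S u → ValidCanon S (a ∷ w) → ValidCanon S (a ∷ u)
  valid-∷ {s} within a {w = w} {u} w⊑u validᵤ validₐ = fin⇒valid S (a ∷ u) check
    where
    inWindow : ∀ k l i j → toℕ k ℕ.< suc s → toℕ l ℕ.< suc s →
      (time S i ℤ.+ + suc (toℕ k)) ℤ.- time S j ≡ + suc (toℕ l) →
      Compatible S j (Vec.lookup (a ∷ u) k ⊞ pitch S i) (Vec.lookup (a ∷ u) l ⊞ pitch S j)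
    inWindow k l i j k<s l<s = transfer-compatible {w = a ∷ w} {a ∷ u} validₐ i j k l
      (⊑-restrict (a ∷ w⊑u) k k<s) (⊑-restrict (a ∷ w⊑u) l l<s)
    unshift : ∀ t u k l → (t ℤ.+ + suc (suc k)) ℤ.- u ≡ + suc (suc l) → (t ℤ.+ + suc k) ℤ.- u ≡ + suc l
    unshift t u k l eq = trans (regroup t u (+ suc k)) (cong (λ z → z ℤ.- + 1) eq)
      where
      regroup : ∀ t u z → (t ℤ.+ z) ℤ.- u ≡ ((t ℤ.+ (+ 1 ℤ.+ z)) ℤ.- u) ℤ.- + 1
      regroup = ℤ-solve
    gapˡ : ∀ t u l → (t ℤ.+ + 1) ℤ.- u ≡ + 1 ℤ.+ l → t ℤ.- u ≡ l
    gapˡ t u l eq = trans (regroup t u) (trans (cong (λ z → z ℤ.- + 1) eq) (cancel l))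
      where
      regroup : ∀ t u → t ℤ.- u ≡ ((t ℤ.+ + 1) ℤ.- u) ℤ.- + 1
      regroup = ℤ-solve
      cancel : ∀ l → (+ 1 ℤ.+ l) ℤ.- + 1 ≡ l
      cancel = ℤ-solve
    gapʳ : ∀ t u k → (t ℤ.+ (+ 1 ℤ.+ k)) ℤ.- u ≡ + 1 → u ℤ.- t ≡ k
    gapʳ t u k eq = trans (regroup t u k) (trans (cong (λ z → (k ℤ.+ + 1) ℤ.- z) eq) (cancel k))
      where
      regroup : ∀ t u k → u ℤ.- t ≡ (k ℤ.+ + 1) ℤ.- ((t ℤ.+ (+ 1 ℤ.+ k)) ℤ.- u)
      regroup = ℤ-solve
      cancel : ∀ k → (k ℤ.+ + 1) ℤ.- + 1 ≡ k
      cancel = ℤ-solve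
    bounded : ∀ i j n → time S i ℤ.- time S j ≡ + n → n ℕ.< suc s
    bounded i j n eq = ℕ.s≤s (ℤ.drop‿+≤+ (subst (ℤ._≤ + s) eq (within i j)))
    -- Two old notes are governed by `u`. If one note is the new one, the time equation makes the
    -- other index a difference of time displacements, hence at most s, and `a ∷ w` has exactly the
    -- indices 0 to s.
    check : ValidCanonFin S (a ∷ u)
    check i j (suc k) (suc l) eq =
      valid⇒fin S u validᵤ i j k l (unshift (time S i) (time S j) (toℕ k) (toℕ l) eq)
    check i j zero    l       eq = inWindow zero l i j (ℕ.s≤s ℕ.z≤n)
      (bounded i j (toℕ l) (gapˡ (time S i) (time S j) (+ toℕ l) eq)) eq
    check i j (suc k) zero    eq = inWindow (suc k) zero i j
      (bounded j i (suc (toℕ k)) (gapʳ (time S i) (time S j) (+ suc (toℕ k)) eq)) (ℕ.s≤s ℕ.z≤n) eq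

  within-totalDisplacement : ∀ i j → time S i ℤ.- time S j ℤ.≤ + totalDisplacement S
  within-totalDisplacement = helper S
    where
    ≤max : ∀ {n} (f : Vector ℤ n) e i → f i ℤ.≤ foldr ℤ._⊔_ e f
    ≤max f e zero    = ℤ.i≤i⊔j (f zero) _
    ≤max f e (suc i) = ℤ.≤-trans (≤max (tail f) e i) (ℤ.i≤j⊔i (f zero) _)
    min≤ : ∀ {n} (f : Vector ℤ n) e i → foldr ℤ._⊓_ e f ℤ.≤ f i
    min≤ f e zero    = ℤ.i⊓j≤i (f zero) _
    min≤ f e (suc i) = ℤ.≤-trans (ℤ.i⊓j≤j (f zero) _) (min≤ (tail f) e i)
    i≤∣i∣ : ∀ i → i ℤ.≤ + ℤ.∣ i ∣
    i≤∣i∣ (+ n)      = ℤ.≤-refl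
    i≤∣i∣ (ℤ.-[1+ n ]) = ℤ.-≤+
    helper : ∀ {r} (S : CanonicScheme r) i j → time S i ℤ.- time S j ℤ.≤ + totalDisplacement S
    helper {suc r} S i j = ℤ.≤-trans
      (ℤ.+-mono-≤ (≤max (time S) (time S zero) i) (ℤ.neg-mono-≤ (min≤ (time S) (time S zero) j)))
      (i≤∣i∣ _)

-- The transfer matrix

module Transfer {r} (S : CanonicScheme r) (s′ : ℕ)
  (within : ∀ i j → time S i ℤ.- time S j ℤ.≤ + suc s′) where

  s : ℕ
  s = suc s′

  opaque
    -- Opaque, so that the decision procedure is not unfolded. The rest of the module knows validity
    -- only as decidable, closed under removing notes at either end, translation invariant, and
    -- local to s + 1 consecutive notes.
    Valid : ∀ {n} → Melody n → Set
    Valid = ValidCanon S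

    valid? : ∀ {n} (x : Melody n) → Dec (Valid x)
    valid? = validCanon? S

    V-valid : ∀ n → V n S ≡ Σmelodies n (λ x → ⟦ valid? x ⟧)
    V-valid = V-Σmelodies S

    valid-behead : ∀ a {n} (x : Melody n) → Valid (a ∷ x) → Valid x
    valid-behead = valid-tail S

    valid-initial : ∀ {n m} {w : Melody n} {u : Melody m} → w ⊑ u → Valid u → Valid w
    valid-initial = valid-⊑ S

    valid-prepend : ∀ a {m} {w : Melody s} {u : Melody m} → w ⊑ u → Valid u → Valid (a ∷ w) → Valid (a ∷ u)
    valid-prepend = valid-∷ S within

    valid-translated : ∀ c {n} (x : Melody n) → Valid x → Valid (translate c x)
    valid-translated = valid-translate⁺ S

    valid-untranslated : ∀ c {n} (x : Melody n) → Valid (translate c x) → Valid x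
    valid-untranslated = valid-translate⁻ S

  -- The number of ways to put n notes in front of a valid canon with initial window w.
  ext : ℕ → Melody s → ℕ
  ext zero    w = 1
  ext (suc n) w = sumℕ λ a → ⟦ valid? (a ∷ w) ⟧ ℕ.* ext n (shift a w)

  -- Unlike `ext`, this tests only the finished melody, so summing it over all `u` counts valid
  -- canons directly.
  prependings : ℕ → ∀ {m} → Melody m → ℕ
  prependings zero    u = ⟦ valid? u ⟧
  prependings (suc n) u = sumℕ λ a → prependings n (a ∷ u)

  Σprependings : ∀ n m → Σmelodies m (prependings n) ≡ V (n ℕ.+ m) S
  Σprependings zero    m = sym (V-valid m)
  Σprependings (suc n) m = trans (Σmelodies-sum m λ a u → prependings n (a ∷ u))
    (trans (Σprependings n (suc m)) (cong (λ k → V k S) (ℕ.+-suc n m)))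

  -- By locality the bracket of `a ∷ u` is that of `u` times that of `a ∷ w`; the first factor
  -- leaves the sum, and what remains depends on the window alone.
  prependings-ext : ∀ n {m} {w : Melody s} {u : Melody m} → w ⊑ u →
                    prependings n u ≡ ⟦ valid? u ⟧ ℕ.* ext n w
  prependings-ext zero    w⊑u = sym (ℕ.*-identityʳ _)
  prependings-ext (suc n) {w = w} {u} w⊑u = trans
    (sumℕ-cong λ a → trans (prependings-ext n (shift-⊑ a w⊑u))
      (trans
        (cong (ℕ._* ext n (shift a w)) (⟦⟧-× (valid? (a ∷ u)) (valid? u) (valid? (a ∷ w))
          (valid-behead a u) (valid-initial (a ∷ w⊑u)) (valid-prepend a w⊑u)))
        (ℕ.*-assoc ⟦ valid? u ⟧ ⟦ valid? (a ∷ w) ⟧ _)))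
    (sym (*-distribˡ-sumℕ ⟦ valid? u ⟧ λ a → ⟦ valid? (a ∷ w) ⟧ ℕ.* ext n (shift a w)))

  ⟦valid⟧-translate : ∀ c {n} (x : Melody n) → ⟦ valid? (translate c x) ⟧ ≡ ⟦ valid? x ⟧
  ⟦valid⟧-translate c x = ⟦⟧-cong (valid? (translate c x)) (valid? x)
    (valid-untranslated c x) (valid-translated c x)

  ext-translate : ∀ c n w → ext n (translate c w) ≡ ext n w
  ext-translate c zero    w = refl
  ext-translate c (suc n) w = trans
    (sym (sumℕ-translate c λ a → ⟦ valid? (a ∷ translate c w) ⟧ ℕ.* ext n (shift a (translate c w))))
    (sumℕ-cong λ a → cong₂ ℕ._*_ (⟦valid⟧-translate c (a ∷ w))
      (trans (cong (ext n) (shift-translate c a w)) (ext-translate c n (shift a w))))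

  -- Canons of length s up to translation.
  states : List (Melody s)
  states = filter valid? (List.map (0F ∷_) (melodies s′))

  N : ℕ
  N = length states

  state : Fin N → Melody s
  state = lookup states

  -- Translating the first note to 0 gives a listed window. Only the equality of extension counts is
  -- kept, since that is all the recurrence needs.
  findState : ∀ w → Valid w → ∃ λ i → ∀ n → ext n w ≡ ext n (state i)
  findState (a ∷ x) valid = index w′∈states , λ n →
    trans (sym (ext-translate c n (a ∷ x))) (cong (ext n) (lookup-index w′∈states))
    where
    c = 0F ⊟ a
    w′∈states : translate c (a ∷ x) ∈ states
    w′∈states = ∈-filter⁺ valid?
      (subst (λ b → b ∷ translate c x ∈ List.map (0F ∷_) (melodies s′)) (sym (a⊞[0⊟a] a))
        (∈-map⁺ (0F ∷_) (∈-melodies (translate c x))))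
      (valid-translated c (a ∷ x) valid)

  state-valid-shift : ∀ i a → Valid (a ∷ state i) → Valid (shift a (state i))
  state-valid-shift i a = valid-initial (shift-⊑ a ⊑-refl)

  -- The decision is an argument, so that the validity proof it may contain can be handed to
  -- `findState` and lemmas can split on it.
  transitions : ∀ i a → Dec (Valid (a ∷ state i)) → Fin N → ℕ
  transitions i a (yes valid) j = δ (proj₁ (findState (shift a (state i)) (state-valid-shift i a valid))) j
  transitions i a (no _)      j = 0

  M : Matrix ℕ N
  M i j = sumℕ λ a → transitions i a (valid? (a ∷ state i)) j

  sumℕ-zero : ∀ n → sumℕ {n} (λ _ → 0) ≡ 0
  sumℕ-zero zero    = refl
  sumℕ-zero (suc n) = sumℕ-zero n

  sumℕ-δ : ∀ {n} (k : Fin n) (f : Fin n → ℕ) → sumℕ (λ j → δ k j ℕ.* f j) ≡ f k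
  sumℕ-δ {suc n} zero    f = trans (cong₂ ℕ._+_ (ℕ.+-identityʳ (f zero)) (sumℕ-zero n)) (ℕ.+-identityʳ (f zero))
  sumℕ-δ         (suc k) f = sumℕ-δ k (f ∘ suc)

  Σtransitions : ∀ n i a (d : Dec (Valid (a ∷ state i))) →
    sumℕ (λ j → transitions i a d j ℕ.* ext n (state j)) ≡ ⟦ d ⟧ ℕ.* ext n (shift a (state i))
  Σtransitions n i a (yes valid) = trans
    (sumℕ-δ (proj₁ found) λ j → ext n (state j))
    (trans (sym (proj₂ found n)) (sym (ℕ.+-identityʳ _)))
    where found = findState (shift a (state i)) (state-valid-shift i a valid)
  Σtransitions n i a (no _)      = sumℕ-zero N

  ext-recurrence : ∀ n i → ext (suc n) (state i) ≡ sumℕ λ j → M i j ℕ.* ext n (state j)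
  ext-recurrence n i = sym (begin
    sumℕ (λ j → M i j ℕ.* f j)
      ≡⟨ sumℕ-cong (λ j → *-distribʳ-sumℕ (f j) λ a → T a j) ⟩
    sumℕ (λ j → sumℕ λ a → T a j ℕ.* f j)
      ≡⟨ sumℕ-comm (λ j a → T a j ℕ.* f j) ⟩
    sumℕ (λ a → sumℕ λ j → T a j ℕ.* f j)
      ≡⟨ sumℕ-cong (λ a → Σtransitions n i a (valid? (a ∷ state i))) ⟩
    ext (suc n) (state i) ∎)
    where
    open ≡-Reasoning
    f : Fin N → ℕ
    f j = ext n (state j)
    T : 𝔽₇ → Fin N → ℕ
    T a = transitions i a (valid? (a ∷ state i))

  V-ext : ∀ n → V (n ℕ.+ s) S ≡ 7 ℕ.* sumℕ λ i → ext n (state i)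
  V-ext n = begin
    V (n ℕ.+ s) S
      ≡⟨ Σprependings n s ⟨
    Σmelodies s (prependings n)
      ≡⟨ Σmelodies-cong s (λ u → prependings-ext n {w = u} {u} ⊑-refl) ⟩
    sumℕ (λ a → Σmelodies s′ λ x → h (a ∷ x))
      -- Translation by a carries the windows beginning with 0 to those beginning with a, so all
      -- seven summands are equal.
      ≡⟨ sumℕ-cong (λ a → trans (sym (Σmelodies-translate a s′ λ x → h (a ∷ x)))
           (Σmelodies-cong s′ λ x → trans (cong (λ b → h (b ∷ translate a x)) (sym (0⊞ a)))
             (h-translate a (0F ∷ x)))) ⟩
    7 ℕ.* Σmelodies s′ (λ x → h (0F ∷ x))
      ≡⟨ cong (7 ℕ.*_) (sym (begin
           sumL (ext n) states                          ≡⟨ sumL-filter valid? (ext n) (List.map (0F ∷_) (melodies s′)) ⟩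
           sumL h (List.map (0F ∷_) (melodies s′))      ≡⟨ sumL-map h (0F ∷_) (melodies s′) ⟩
           sumL (λ x → h (0F ∷ x)) (melodies s′)        ≡⟨ sumL-melodies s′ _ ⟩
           Σmelodies s′ (λ x → h (0F ∷ x))              ∎)) ⟩
    7 ℕ.* sumℕ (λ i → ext n (state i)) ∎
    where
    open ≡-Reasoning
    h : Melody s → ℕ
    h u = ⟦ valid? u ⟧ ℕ.* ext n u
    h-translate : ∀ c u → h (translate c u) ≡ h u
    h-translate c u = cong₂ ℕ._*_ (⟦valid⟧-translate c u) (ext-translate c n u)

  V-states : V s S ≡ 7 ℕ.* N
  V-states = trans (V-ext 0) (cong (7 ℕ.*_) (sumL-one states))

  N≤ : N ≤ℕ 7 ^ s′
  N≤ = ℕ.≤-trans (List.length-filter valid? (List.map (0F ∷_) (melodies s′)))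
    (ℕ.≤-reflexive (trans (List.length-map (0F ∷_) (melodies s′))
      (trans (sym (sumL-one (melodies s′))) (trans (sumL-melodies s′ _) (Σmelodies-one s′)))))

-- Positive displacement, division by 7, and conclusion

totalDisplacement≢0 : ∀ {r} (S : CanonicScheme r) → 2 ≤ℕ r → totalDisplacement S ≢ 0
totalDisplacement≢0 {suc (suc r)} S (ℕ.s≤s (ℕ.s≤s _)) s≡0 =
  contradiction (time-injective S (ℤ.≤-antisym (time≤ 0F 1F) (time≤ 1F 0F))) λ ()
  where
  time≤ : ∀ i j → time S i ℤ.≤ time S j
  time≤ i j = ℤ.i-j≤0⇒i≤j (subst (λ s → time S i ℤ.- time S j ℤ.≤ + s) s≡0 (within-totalDisplacement S i j))

/1≤/7 : ∀ {m n} → 7 ℕ.* m ≤ℕ n → + m / 1 ≤ + n / 7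
/1≤/7 {m} {n} 7m≤n = fromℚᵘ-mono-≤ {mkℚᵘ (+ m) 0} {mkℚᵘ (+ n) 6} (ℚᵘ.*≤*
  (subst₂ ℤ._≤_ (ℤ.pos-* m 7) (ℤ.pos-* n 1)
    (ℤ.+≤+ (subst₂ _≤ℕ_ (ℕ.*-comm 7 m) (sym (ℕ.*-identityʳ n)) 7m≤n))))

/7≤/1 : ∀ {m n} → n ≤ℕ 7 ℕ.* m → + n / 7 ≤ + m / 1
/7≤/1 {m} {n} n≤7m = fromℚᵘ-mono-≤ {mkℚᵘ (+ n) 6} {mkℚᵘ (+ m) 0} (ℚᵘ.*≤*
  (subst₂ ℤ._≤_ (ℤ.pos-* n 1) (ℤ.pos-* m 7)
    (ℤ.+≤+ (subst₂ _≤ℕ_ (sym (ℕ.*-identityʳ n)) (ℕ.*-comm 7 m) n≤7m))))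

theorem6p1 : ∀ {r : ℕ} (S : CanonicScheme r) → 2 ≤ℕ r →
    let s = totalDisplacement S in
    (Σ ℝ λ L → IsFlexibility S L ×
    (Σ ℕ λ d → Σ (Vec ℤ d) λ c →
    evalMonic c L ≈ᴿ fromℕ 0 ×
    (V s S ≢ 0 → + d / 1 ≤ + V s S / 7)))
    × + V s S / 7 ≤ + (7 ^ (s ∸ 1)) / 1
theorem6p1 {r} S 2≤r = at (totalDisplacement S) refl
  where
  -- The displacement is generalised to a variable, so that it can be matched as `suc s′`.
  at : ∀ s → totalDisplacement S ≡ s →
    (Σ ℝ λ L → IsFlexibility S L ×
    (Σ ℕ λ d → Σ (Vec ℤ d) λ c →
    evalMonic c L ≈ᴿ fromℕ 0 ×
    (V s S ≢ 0 → + d / 1 ≤ + V s S / 7)))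
    × + V s S / 7 ≤ + (7 ^ (s ∸ 1)) / 1
  at zero     s≡0 = contradiction s≡0 (totalDisplacement≢0 S 2≤r)
  at (suc s′) s≡  =
    (L , flexibility , d , c , isRoot , λ V≢0 → /1≤/7 {d} {V s S}
      (ℕ.≤-trans (ℕ.*-monoʳ-≤ 7 (d≤N V≢0)) (ℕ.≤-reflexive (sym V-states)))) ,
    /7≤/1 {7 ^ s′} {V s S} (ℕ.≤-trans (ℕ.≤-reflexive V-states) (ℕ.*-monoʳ-≤ 7 N≤))
    where
    open Transfer S s′ (λ i j → subst (λ s → time S i ℤ.- time S j ℤ.≤ + s) s≡ (within-totalDisplacement S i j))
    growth : Σ ℝ λ L → HasRootLimit (λ n → V n S) L × Σ ℕ λ d → Σ (Vec ℤ d) λ c →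
             evalMonic c L ≈ᴿ fromℕ 0 × (V s S ≢ 0 → d ≤ℕ N)
    -- The argument 6 encodes the factor 7 = 6 + 1, the number of translates of a window.
    growth = walkGrowth (λ n → V n S) s 6 N M (λ n i → ext n (state i)) (λ _ → refl) ext-recurrence V-ext
    L = proj₁ growth
    flexibility = proj₁ (proj₂ growth)
    d = proj₁ (proj₂ (proj₂ growth))
    c = proj₁ (proj₂ (proj₂ (proj₂ growth)))
    isRoot = proj₁ (proj₂ (proj₂ (proj₂ (proj₂ growth))))
    d≤N = proj₂ (proj₂ (proj₂ (proj₂ (proj₂ growth))))
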